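{- Let $G$ be a finite nontrivial nilpotent group none of whose Sylow subgroups is cyclic or generalized quaternion. (a) If $G$ is a $p$-group for a prime $p$, having exactly $r$ distinct subgroups of order $p$, and $\mathcal{G}_E^{**}(G)$ has a total dominating set, then $\gamma^{\text{strong}}(\mathcal{G}_E^{**}(G))=2r$. (b) If $G=P_1\times\cdots\times P_m$ with $m\geq 2$, where $P_1,\dots,P_m$ are the Sylow subgroups of $G$ for the distinct prime divisors $p_1,\dots,p_m$ of $|G|$ and $r_i$ is the number of distinct subgroups of order $p_i$ in $P_i$, then $\gamma^{\text{strong}}(\mathcal{G}_E^{**}(G))=\left(\min_{1\leq i\leq m} r_i\right)+1$.
   Context: The enhanced power graph $\mathcal{G}_E(G)$ of a group $G$ is the simple graph with vertex set $G$ in which two distinct vertices $u,v$ are adjacent if and only if there is $w\in G$ with $u\in\langle w\rangle$ and $v\in\langle w\rangle$. A dominating vertex of a graph is a vertex adjacent to every other vertex. The proper enhanced power graph $\mathcal{G}_E^{**}(G)$ is the graph obtained from $\mathcal{G}_E(G)$ by deleting all of its dominating vertices (including the identity). A total dominating set (or strongly dominating set) of a graph $\Gamma=(V,E)$ is a set $D\subseteq V$ such that every vertex $u\in V$ (including those in $D$) is adjacent to some $v\in D$. The strong domination number $\gamma^{\text{strong}}(\Gamma)$ is the minimum cardinality of a total dominating set of $\Gamma$. The generalized quaternion group $Q_{2^k}$ ($k\geq 3$) is the group of order $2^k$ generated by $x,y$ with $x^{2^{k-1}}=1$, $x^{2^{k-2}}=y^2$ and $yxy^{ -1}=x^{ -1}$.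 -}

module Defs where

open import Algebra.Bundles using (Group)
import Algebra.Definitions.RawMonoid as RawMonoidDefs
open import Data.Fin.Base using (Fin)
open import Data.Integer.Base using (ℤ; +_; -[1+_])
open import Data.Nat.Base using (ℕ; suc; _∸_; _≤_)
import Data.Nat.Base as ℕ
open import Data.Nat.Divisibility using (_∣_; _∤_)
open import Data.Product.Base using (Σ; ∃; ∃-syntax; ∃₂; _×_; _,_; proj₁; proj₂)
open import Data.Sum.Base using (_⊎_)
open import Function.Base using (_∘_)
open import Function.Bundles using (Inverse)
open import Level using (Level; _⊔_) renaming (suc to lsuc)
open import Relation.Binary.Bundles using (Setoid)
open import Relation.Binary.Core using (Rel)
open import Relation.Binary.Definitions using (Symmetric; _Respects_; _Respects₂_)
import Relation.Binary.Construct.On as On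
import Relation.Binary.PropositionalEquality.Properties as ≡
open import Relation.Nullary.Negation using (¬_)
open import Relation.Unary using (Pred; _∈_; _∉_; _⊆_; _≐_)
open import Relation.Unary.Properties using (≐-refl; ≐-sym; ≐-trans)

private
  variable
    a b c e ℓ : Level

HasCardinality : Setoid a b → ℕ → Set (a ⊔ b)
HasCardinality S k = Inverse S (≡.setoid (Fin k))

restrict : (S : Setoid a b) → Pred (Setoid.Carrier S) e → Setoid (a ⊔ e) b
restrict S P = On.setoid S (proj₁ {B = P})

IsLeast : Pred ℕ e → ℕ → Set e
IsLeast S k = k ∈ S × (∀ j → j ∈ S → k ≤ j)

------------------------------------------------------------------------
-- Simple graphs, with vertices taken up to a setoid equality

record Graph (a b e : Level) : Set (lsuc (a ⊔ b ⊔ e)) where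
  field
    vertices : Setoid a b

  open Setoid vertices public using (_≈_; _≉_) renaming (Carrier to Vertex)

  field
    _~_    : Rel Vertex e
    ~-sym  : Symmetric _~_
    ~-irr  : ∀ {u v} → u ≈ v → ¬ (u ~ v)
    ~-resp : _~_ Respects₂ _≈_

module _ (Γ : Graph a b e) where
  open Graph Γ

  IsDominatingVertex : Pred Vertex (a ⊔ b ⊔ e)
  IsDominatingVertex v = ∀ u → u ≉ v → v ~ u

  deleteDominating : Graph (a ⊔ b ⊔ e) b e
  deleteDominating = record
    { vertices = restrict vertices (_∉ IsDominatingVertex)
    ; _~_      = λ u v → proj₁ u ~ proj₁ v
    ; ~-sym    = ~-sym
    ; ~-irr    = ~-irr
    ; ~-resp   = proj₁ ~-resp , proj₂ ~-resp
    }

  -- The level b of the vertex equality suffices for every finite subset: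
  -- the one listed by f : Fin k → Vertex is λ v → ∃ λ i → v ≈ f i.
  record VertexSet : Set (a ⊔ lsuc b) where
    field
      member : Pred Vertex b
      resp   : member Respects _≈_

    elements : Setoid (a ⊔ b) b
    elements = restrict vertices member

  open VertexSet

  IsTotalDominating : VertexSet → Set (a ⊔ b ⊔ e)
  IsTotalDominating D = ∀ u → ∃[ v ] v ∈ member D × u ~ v

  HasTotalDominatingSet : Set (a ⊔ lsuc b ⊔ e)
  HasTotalDominatingSet = ∃[ D ] IsTotalDominating D

  IsStrongDominationNumber : ℕ → Set (a ⊔ lsuc b ⊔ e)
  IsStrongDominationNumber = IsLeast λ k →
    ∃[ D ] IsTotalDominating D × HasCardinality (elements D) k

------------------------------------------------------------------------
-- Groups

module _ (G : Group c ℓ) where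
  open Group G
  open RawMonoidDefs rawMonoid using (sum) renaming (_×_ to _·_)

  HasOrder : ℕ → Set (c ⊔ ℓ)
  HasOrder = HasCardinality setoid

  IsNontrivial : Set (c ⊔ ℓ)
  IsNontrivial = ∃[ x ] x ≉ ε

  infixr 8 _^_
  _^_ : Carrier → ℤ → Carrier
  x ^ (+ n)    = n · x
  x ^ -[1+ n ] = (suc n · x) ⁻¹

  ⟨_⟩ : Carrier → Pred Carrier ℓ
  ⟨ w ⟩ x = ∃[ k ] x ≈ w ^ k

  data Generated {s} (S : Pred Carrier s) : Pred Carrier (c ⊔ ℓ ⊔ s) where
    gen      : ∀ {x} → x ∈ S → x ∈ Generated S
    gen-ε    : ε ∈ Generated S
    gen-∙    : ∀ {x y} → x ∈ Generated S → y ∈ Generated S → x ∙ y ∈ Generated S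
    gen-⁻¹   : ∀ {x} → x ∈ Generated S → x ⁻¹ ∈ Generated S
    gen-resp : ∀ {x y} → x ≈ y → x ∈ Generated S → y ∈ Generated S

  IsCyclic : Set (c ⊔ ℓ)
  IsCyclic = ∃[ w ] ∀ x → x ∈ ⟨ w ⟩

  -- The presentation together with the order 2ᵏ determines the group.
  IsGeneralizedQuaternion : Set (c ⊔ ℓ)
  IsGeneralizedQuaternion = ∃[ k ] 3 ≤ k × HasOrder (2 ℕ.^ k) ×
    ∃₂ λ x y →
        (∀ g → g ∈ Generated (λ z → z ≈ x ⊎ z ≈ y))
      × x ^ (+ (2 ℕ.^ (k ∸ 1))) ≈ ε
      × x ^ (+ (2 ℕ.^ (k ∸ 2))) ≈ y ^ (+ 2)
      × y ∙ x ∙ y ⁻¹ ≈ x ⁻¹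

  -- For finite groups only.
  IsPGroup : ℕ → Set (c ⊔ ℓ)
  IsPGroup p = ∃[ k ] HasOrder (p ℕ.^ k)

  -- The upper central series: x ∈ Zᵢ₊₁ iff [x , g] ∈ Zᵢ for all g.
  data UpperCentral : ℕ → Pred Carrier (c ⊔ ℓ) where
    trivial : ∀ {x} → x ≈ ε → x ∈ UpperCentral 0
    central : ∀ {i x} → (∀ g → x ⁻¹ ∙ g ⁻¹ ∙ x ∙ g ∈ UpperCentral i) →
              x ∈ UpperCentral (suc i)

  IsNilpotent : Set (c ⊔ ℓ)
  IsNilpotent = ∃[ i ] ∀ x → x ∈ UpperCentral i

  -- As for VertexSet, the level ℓ suffices for every finite subgroup.
  record Subgroup : Set (c ⊔ lsuc ℓ) where
    field
      member    : Pred Carrier ℓ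
      resp      : member Respects _≈_
      ε-closed  : ε ∈ member
      ∙-closed  : ∀ {x y} → x ∈ member → y ∈ member → x ∙ y ∈ member
      ⁻¹-closed : ∀ {x} → x ∈ member → x ⁻¹ ∈ member

    group : Group (c ⊔ ℓ) ℓ
    group = record
      { Carrier = Σ Carrier member
      ; _≈_     = λ x y → proj₁ x ≈ proj₁ y
      ; _∙_     = λ x y → proj₁ x ∙ proj₁ y , ∙-closed (proj₂ x) (proj₂ y)
      ; ε       = ε , ε-closed
      ; _⁻¹     = λ x → proj₁ x ⁻¹ , ⁻¹-closed (proj₂ x)
      ; isGroup = record
        { isMonoid = record
          { isSemigroup = record
            { isMagma = record
              { isEquivalence = On.isEquivalence proj₁ isEquivalence
              ; ∙-cong        = ∙-cong
              }
            ; assoc = λ x y z → assoc (proj₁ x) (proj₁ y) (proj₁ z)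
            }
          ; identity = identityˡ ∘ proj₁ , identityʳ ∘ proj₁
          }
        ; inverse = inverseˡ ∘ proj₁ , inverseʳ ∘ proj₁
        ; ⁻¹-cong = ⁻¹-cong
        }
      }

  subgroups : Setoid (c ⊔ lsuc ℓ) (c ⊔ ℓ)
  subgroups = record
    { Carrier       = Subgroup
    ; _≈_           = λ H K → Subgroup.member H ≐ Subgroup.member K
    ; isEquivalence = record { refl = ≐-refl ; sym = ≐-sym ; trans = ≐-trans }
    }

  IsNormal : Subgroup → Set (c ⊔ ℓ)
  IsNormal H = ∀ g {x} → x ∈ member → g ∙ x ∙ g ⁻¹ ∈ member
    where open Subgroup H

  -- Internal direct product.  `sum` is the product x₀ ∙ x₁ ∙ ⋯ ∙ xₘ₋₁; the
  -- library writes monoids additively there.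
  IsDirectProduct : ∀ {m} → (Fin m → Subgroup) → Set (c ⊔ ℓ)
  IsDirectProduct {m} P = (∀ i → IsNormal (P i)) ×
    (∀ g → ∃[ x ] IsFactorization g x ×
                  (∀ y → IsFactorization g y → ∀ i → y i ≈ x i))
    where
    IsFactorization : Carrier → (Fin m → Carrier) → Set ℓ
    IsFactorization g x = (∀ i → x i ∈ Subgroup.member (P i)) × sum x ≈ g

  enhancedPowerGraph : Graph c ℓ (c ⊔ ℓ)
  enhancedPowerGraph = record
    { vertices = setoid
    ; _~_      = λ u v → u ≉ v × ∃[ w ] u ∈ ⟨ w ⟩ × v ∈ ⟨ w ⟩
    ; ~-sym    = λ (u≉v , w , u∈ , v∈) → u≉v ∘ sym , w , v∈ , u∈
    ; ~-irr    = λ u≈v u~v → proj₁ u~v u≈v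
    ; ~-resp   =
        (λ v≈v′ (u≉v , w , u∈ , (k , v≈wᵏ)) →
           (λ u≈v′ → u≉v (trans u≈v′ (sym v≈v′))) ,
           w , u∈ , (k , trans (sym v≈v′) v≈wᵏ))
      , (λ u≈u′ (u≉v , w , (k , u≈wᵏ) , v∈) →
           (λ u′≈v → u≉v (trans u≈u′ u′≈v)) ,
           w , (k , trans (sym u≈u′) u≈wᵏ) , v∈)
    }

  properEnhancedPowerGraph : Graph (c ⊔ ℓ) ℓ (c ⊔ ℓ)
  properEnhancedPowerGraph = deleteDominating enhancedPowerGraph

module _ {G : Group c ℓ} where
  open Subgroup

  IsSylow : ℕ → Subgroup G → Set (c ⊔ ℓ)
  IsSylow p P = ∃₂ λ n k →
    HasOrder G n × HasOrder (group P) (p ℕ.^ k) × p ℕ.^ k ∣ n × p ℕ.^ suc k ∤ n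

  subgroupsOfOrder : ℕ → Setoid (c ⊔ lsuc ℓ) (c ⊔ ℓ)
  subgroupsOfOrder k = restrict (subgroups G) (λ H → HasOrder (group H) k)

  subgroupsOfOrderIn : ℕ → Subgroup G → Setoid (c ⊔ lsuc ℓ) (c ⊔ ℓ)
  subgroupsOfOrderIn k P = restrict (subgroups G)
    (λ H → member H ⊆ member P × HasOrder (group H) k)

{-# OPTIONS --safe #-}

-- The deep ingredient is that a p-group with a single subgroup of order p is
-- cyclic or generalized quaternion, so that under the hypotheses every Sylow
-- subgroup has at least two subgroups of prime order and the identity is the
-- only dominating vertex.  To prove it, take a normal cyclic subgroup A = ⟪ x ⟫
-- maximal among such subgroups, and y ∉ A with y central modulo A and yᵖ ∈ A.
-- If y acts on A as the a-th power with a ≡ 1 modulo p (modulo 4 for p = 2),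
-- then correcting y by powers of x yields an element of order p outside A.
-- This leaves A = G, or p = 2 with every element outside A inverting x.
--
-- Adjacent vertices lie in one cyclic group, which has at most one subgroup of
-- each prime order.  In a p-group the vertices above a given subgroup of order p
-- therefore form a component; it needs two vertices, and a generator of that
-- subgroup with any neighbour suffices.  In a product of several Sylow subgroups,
-- generators of all subgroups of order pᵢ and one element of order pⱼ dominate.
-- Conversely, for some i a total dominating set has a vertex above each subgroup
-- of order pᵢ, and a neighbour of one of these vertices in addition.

module Submission where

open import Defs
open import Algebra.Bundles using (Group)
import Algebra.Properties.Group
import Algebra.Properties.Monoid.Mult
open import Data.Empty using (⊥; ⊥-elim)
open import Data.Fin.Base as Fin using (Fin; fromℕ<; toℕ)
import Data.Fin.Properties as Fin
open import Data.Integer.Base using (+_; -[1+_])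
import Data.Nat.Base as ℕ
open import Data.Nat.Base using (_*_; _+_; _<_; _∸_; _≤_; suc; s≤s; zero; z≤n; ℕ)
import Data.Nat.Coprimality as Coprime
open import Data.Nat.Coprimality using (Coprime; coprime-Bézout; coprime-divisor; prime⇒coprime)
open import Data.Nat.DivMod using (_%_; m%n<n; m≡m%n+[m/n]*n)
open import Data.Nat.Divisibility using (*-cancelˡ-∣; *-monoˡ-∣; _∣?_; _∣_; _∤_; divides; divides-refl; m%n≡0⇒n∣m;
  m∣m*n; n∣m*n; quotient; ∣-refl; ∣-trans; ∣1⇒≡1; ∣m+n∣m⇒∣n; ∣⇒≤)
open import Data.Nat.GCD using (module Bézout)
open import Data.Nat.Induction using (<-wellFounded; Acc; acc)
open import Data.Nat.Primality using (Prime; prime[2]; prime⇒irreducible; prime⇒nonTrivial; prime⇒nonZero; ¬prime[1])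
import Data.Nat.Properties as ℕ
open import Data.Nat.Tactic.RingSolver using (solve-∀)
open import Data.Product.Base using (_,_; _×_; proj₁; proj₂; uncurry; Σ; Σ-syntax; ∃; ∃-syntax; ∃₂)
open import Data.Sum.Base using (_⊎_; inj₁; inj₂)
import Data.Vec.Functional as Vector
open import Function.Base using (_∘_; id)
open import Function.Bundles using (Equivalence; Inverse; _⇔_)
open import Function.Definitions using (Injective)
open import Level using (Level; _⊔_)
open import Relation.Binary.Bundles using (Setoid)
open import Relation.Binary.Definitions using (_Respects_; tri<; tri>; tri≈)
open import Relation.Binary.PropositionalEquality.Core as ≡ using (_≡_; _≢_; cong; subst)
import Relation.Binary.Reasoning.Setoid as ≈-Reasoning
open import Relation.Nullary.Decidable using (Dec; _×-dec_; decidable-stable; map′; no; yes; ¬?)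
open import Relation.Nullary.Negation using (contradiction; ¬_)
open import Relation.Unary using (Pred; _∈_; _∉_)
open import Tactic.MonoidSolver using (solve)

private variable
  ℓ₁ ℓ₂ ℓ₃ : Level

-- Finite setoids

module Finite (S : Setoid ℓ₁ ℓ₂) {k : ℕ} (card : HasCardinality S k) where
  open Setoid S
  open Inverse card

  index-injective : ∀ {x y} → to x ≡ to y → x ≈ y
  index-injective eq =
    trans (sym (strictlyInverseʳ _)) (trans (from-cong eq) (strictlyInverseʳ _))

  infix 4 _≟_
  _≟_ : ∀ x y → Dec (x ≈ y)
  x ≟ y = map′ index-injective to-cong (to x Fin.≟ to y)

  any? : {P : Pred Carrier ℓ₃} → P Respects _≈_ → (∀ x → Dec (P x)) → Dec (∃ P)
  any? resp P? = map′ (λ (i , p) → from i , p)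
                      (λ (x , p) → to x , resp (sym (strictlyInverseʳ x)) p)
                      (Fin.any? (P? ∘ from))

  all? : {P : Pred Carrier ℓ₃} → P Respects _≈_ → (∀ x → Dec (P x)) → Dec (∀ x → P x)
  all? resp P? = map′ (λ p x → resp (strictlyInverseʳ x) (p (to x)))
                      (λ p i → p (from i))
                      (Fin.all? (P? ∘ from))

  ∀⊎∃¬ : {P : Pred Carrier ℓ₃} → P Respects _≈_ → (∀ x → Dec (P x)) →
         (∀ x → P x) ⊎ (∃[ x ] ¬ P x)
  ∀⊎∃¬ resp P? with any? (λ x≈y ¬p → ¬p ∘ resp (sym x≈y)) (¬? ∘ P?)
  ... | yes ∃¬ = inj₂ ∃¬
  ... | no ¬∃¬ = inj₁ λ x → decidable-stable (P? x) λ ¬p → ¬∃¬ (x , ¬p)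

  injection⇒≤ : ∀ {j} (f : Fin j → Carrier) →
                (∀ {i i′} → f i ≈ f i′ → i ≡ i′) → j ≤ k
  injection⇒≤ f inj = Fin.injective⇒≤ {f = to ∘ f} (inj ∘ index-injective)

  collision : ∀ {j} → k < j → (f : Fin j → Carrier) →
              ∃₂ λ i i′ → i Fin.< i′ × f i ≈ f i′
  collision k<j f =
    let i , i′ , i<i′ , eq = Fin.pigeonhole k<j (to ∘ f)
    in i , i′ , i<i′ , index-injective eq

card-unique : {S : Setoid ℓ₁ ℓ₂} → ∀ {j k} → HasCardinality S j → HasCardinality S k → j ≡ k
card-unique {S = S} cj ck = ℕ.≤-antisym (le cj ck) (le ck cj)
  where
  le : ∀ {j k} → HasCardinality S j → HasCardinality S k → j ≤ k
  le cj ck = Finite.injection⇒≤ S ck (Inverse.from cj) λ eq →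
    ≡.trans (≡.sym (Inverse.strictlyInverseˡ cj _))
            (≡.trans (Inverse.to-cong cj eq) (Inverse.strictlyInverseˡ cj _))

module _ (S : Setoid ℓ₁ ℓ₂) where
  open Setoid S

  bijection⇒card : ∀ {k} (f : Fin k → Carrier) → (∀ {i j} → f i ≈ f j → i ≡ j) →
                   (∀ x → ∃[ i ] x ≈ f i) → HasCardinality S k
  bijection⇒card f inj surj = record
    { to        = proj₁ ∘ surj
    ; from      = f
    ; to-cong   = λ x≈y → inj (trans (sym (proj₂ (surj _))) (trans x≈y (proj₂ (surj _))))
    ; from-cong = λ { ≡.refl → refl }
    ; inverse   = (λ y≈fx → inj (trans (sym (proj₂ (surj _))) y≈fx))
                , (λ { ≡.refl → sym (proj₂ (surj _)) })
    }

-- Arithmetic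

least : {P : Pred ℕ ℓ₁} → (∀ m → Dec (P m)) → ∀ {m} → P m →
        ∃[ d ] P d × (∀ {i} → i < d → ¬ P i)
least {P = P} P? {m} = go (<-wellFounded m)
  where
  go : ∀ {m} → Acc _<_ m → P m → ∃[ d ] P d × (∀ {i} → i < d → ¬ P i)
  go {m} (acc rec) Pm with ℕ.anyUpTo? P? m
  ... | yes (i , i<m , Pi) = go (rec i<m) Pi
  ... | no  none           = m , Pm , λ i<m Pi → none (_ , i<m , Pi)

coprime-* : ∀ {m j k} → Coprime m j → Coprime m k → Coprime m (j * k)
coprime-* cj ck (d∣m , d∣jk) =
  ck (d∣m , coprime-divisor (λ (c∣d , c∣j) → cj (∣-trans c∣d d∣m , c∣j)) d∣jk)

coprime-^ : ∀ {m p} k → Coprime m p → Coprime m (p ℕ.^ k)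
coprime-^ zero    c (_ , d∣1) = ∣1⇒≡1 d∣1
coprime-^ (suc k) c           = coprime-* c (coprime-^ k c)

prime∤⇒coprime : ∀ {p m} → Prime p → p ∤ m → Coprime m p
prime∤⇒coprime prime-p p∤m (d∣m , d∣p) with prime⇒irreducible prime-p d∣p
... | inj₁ d≡1    = d≡1
... | inj₂ ≡.refl = contradiction d∣m p∤m

distinct-primes-coprime : ∀ {p q} → Prime p → Prime q → p ≢ q → Coprime p q
distinct-primes-coprime prime-p prime-q p≢q = prime∤⇒coprime prime-q λ q∣p →
  case (prime⇒irreducible prime-p q∣p)
  where
  case : _ → ⊥
  case (inj₁ ≡.refl) = ¬prime[1] prime-q
  case (inj₂ q≡p)    = p≢q (≡.sym q≡p)

parity : ∀ m → (∃[ h ] m ≡ 2 * h) ⊎ (∃[ h ] m ≡ 1 + 2 * h)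
parity zero = inj₁ (0 , ≡.refl)
parity (suc m) with parity m
... | inj₁ (h , ≡.refl) = inj₂ (h , ≡.refl)
... | inj₂ (h , ≡.refl) = inj₁ (suc h , double h)
  where
  double : ∀ h → 2 + 2 * h ≡ 2 * suc h
  double = solve-∀

odd-coprime-2 : ∀ h → Coprime (1 + 2 * h) 2
odd-coprime-2 h = prime∤⇒coprime prime[2] λ 2∣1+2h →
  contradiction (∣1⇒≡1 (∣m+n∣m⇒∣n (subst (2 ∣_) (ℕ.+-comm 1 (2 * h)) 2∣1+2h) (m∣m*n h))) λ ()

geometric : ℕ → ℕ → ℕ
geometric a zero    = 0
geometric a (suc m) = a * geometric a m + 1

-- The sum 0 + 1 + ⋯ + (m - 1), so the index is shifted by one from the usual triangular numbers.
triangular : ℕ → ℕ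
triangular zero    = 0
triangular (suc m) = triangular m + m

triangular-odd : ∀ h → triangular (1 + 2 * h) ≡ h * (1 + 2 * h)
triangular-odd zero = ≡.refl
triangular-odd (suc h) = ≡.trans (cong triangular (index h))
  (≡.trans (cong (λ t → t + (1 + 2 * h) + (2 + 2 * h)) (triangular-odd h)) (step h))
  where
  index : ∀ h → 1 + 2 * suc h ≡ 2 + (1 + 2 * h)
  index = solve-∀
  step : ∀ h → h * (1 + 2 * h) + (1 + 2 * h) + (2 + 2 * h) ≡ suc h * (1 + 2 * suc h)
  step = solve-∀

-- Modulo p² the i-th power of 1 + pt is 1 + ipt; summing over i < m leaves the triangular number as
-- coefficient of pt.
geometric-expansion : ∀ p t m →
  ∃[ u ] geometric (1 + p * t) m ≡ m + p * t * triangular m + p * p * u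
geometric-expansion p t zero = 0 , base p t
  where
  base : ∀ p t → 0 ≡ p * t * 0 + p * p * 0
  base = solve-∀
geometric-expansion p t (suc m) =
  let u , eq = geometric-expansion p t m
      τ      = triangular m
  in t * (t * τ + p * u) + u ,
     ≡.trans (cong (λ g → (1 + p * t) * g + 1) eq) (step p t m τ u)
  where
  step : ∀ p t m τ u → (1 + p * t) * (m + p * t * τ + p * p * u) + 1 ≡
         suc m + p * t * (τ + m) + p * p * (t * (t * τ + p * u) + u)
  step = solve-∀

-- For odd p the linear term pt · p (p - 1) / 2 is itself divisible by p². For p = 2 this is lost,
-- whence the condition modulo 4 there.
geometric-odd : ∀ {p} h t → p ≡ 1 + 2 * h →
                ∃[ u ] geometric (1 + p * t) p ≡ p + p * p * u
geometric-odd {p} h t ≡.refl =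
  let u , eq = geometric-expansion p t p
  in t * h + u ,
     ≡.trans eq (≡.trans (cong (λ τ → p + p * t * τ + p * p * u) (triangular-odd h)) (step p t h u))
  where
  step : ∀ p t h u → p + p * t * (h * p) + p * p * u ≡ p + p * p * (t * h + u)
  step = solve-∀

-- Powers and finite groups

module Powers {c ℓ} (G : Group c ℓ) where
  open Group G
  open Algebra.Properties.Group G
  open Algebra.Properties.Monoid.Mult monoid public
    renaming (_×_ to _·_; ×-congʳ to ·-congʳ; ×-homo-1 to ·-homo-1;
              ×-homo-+ to ·-homo-+; ×-assocˡ to ·-assoc)
    using ()
  open ≈-Reasoning setoid

  Commute : Carrier → Carrier → Set ℓ
  Commute x y = x ∙ y ≈ y ∙ x

  -- Natural exponents replace the integers of `⟨_⟩`; in a finite group both give the same subgroup.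
  ⟪_⟫ : Carrier → Pred Carrier ℓ
  ⟪ w ⟫ x = ∃[ k ] x ≈ k · w

  ·-ε : ∀ k → k · ε ≈ ε
  ·-ε zero    = refl
  ·-ε (suc k) = trans (identityˡ _) (·-ε k)

  ·-cong-≡ : ∀ {j k} x → j ≡ k → j · x ≈ k · x
  ·-cong-≡ x ≡.refl = refl

  -- The hypothesis says that v is the conjugate of u by y, so powers are conjugated to powers. The
  -- inverse-free form also covers commuting elements, as the case u = v.
  slide : ∀ {u v y} → u ∙ y ≈ y ∙ v → ∀ k → (k · u) ∙ y ≈ y ∙ (k · v)
  slide eq zero    = trans (identityˡ _) (sym (identityʳ _))
  slide {u} {v} {y} eq (suc k) = begin
    (u ∙ k · u) ∙ y ≈⟨ assoc _ _ _ ⟩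
    u ∙ (k · u ∙ y) ≈⟨ ∙-congˡ (slide eq k) ⟩
    u ∙ (y ∙ k · v) ≈⟨ assoc _ _ _ ⟨
    (u ∙ y) ∙ k · v ≈⟨ ∙-congʳ eq ⟩
    (y ∙ v) ∙ k · v ≈⟨ assoc _ _ _ ⟩
    y ∙ (v ∙ k · v) ∎

  ·-commute : ∀ {x y} → Commute x y → ∀ k → Commute (k · x) y
  ·-commute = slide

  ·-distrib : ∀ {x y} → Commute x y → ∀ k → k · (x ∙ y) ≈ k · x ∙ k · y
  ·-distrib xy zero    = sym (identityʳ ε)
  ·-distrib {x} {y} xy (suc k) = begin
    (x ∙ y) ∙ k · (x ∙ y)     ≈⟨ ∙-congˡ (·-distrib xy k) ⟩
    (x ∙ y) ∙ (k · x ∙ k · y) ≈⟨ assoc _ _ _ ⟩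
    x ∙ (y ∙ (k · x ∙ k · y)) ≈⟨ ∙-congˡ (assoc _ _ _) ⟨
    x ∙ ((y ∙ k · x) ∙ k · y) ≈⟨ ∙-congˡ (∙-congʳ (·-commute xy k)) ⟨
    x ∙ ((k · x ∙ y) ∙ k · y) ≈⟨ ∙-congˡ (assoc _ _ _) ⟩
    x ∙ (k · x ∙ (y ∙ k · y)) ≈⟨ assoc _ _ _ ⟨
    (x ∙ k · x) ∙ (y ∙ k · y) ∎

  ·-swap : ∀ j k x → j · (k · x) ≈ k · (j · x)
  ·-swap j k x = trans (·-assoc x j k)
    (trans (·-cong-≡ x (ℕ.*-comm j k)) (sym (·-assoc x k j)))

  ·-kill : ∀ {m k x} → m ∣ k → m · x ≈ ε → k · x ≈ ε
  ·-kill {m} {x = x} (divides-refl q) mx≈ε =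
    trans (sym (·-assoc x q m)) (trans (·-congʳ q mx≈ε) (·-ε q))

  ·-difference : ∀ {i j x} → i ≤ j → i · x ≈ j · x → (j ∸ i) · x ≈ ε
  ·-difference {i} {j} {x} i≤j eq = ∙-cancelˡ (i · x) _ _ (begin
    i · x ∙ (j ∸ i) · x ≈⟨ ·-homo-+ x i (j ∸ i) ⟨
    (i + (j ∸ i)) · x   ≈⟨ ·-cong-≡ x (ℕ.m+[n∸m]≡n i≤j) ⟩
    j · x               ≈⟨ eq ⟨
    i · x               ≈⟨ identityʳ _ ⟨
    i · x ∙ ε           ∎)

  ∈-self : ∀ {w} → w ∈ ⟪ w ⟫
  ∈-self {w} = 1 , sym (·-homo-1 w)

  ∈-resp : ∀ {w x y} → x ≈ y → x ∈ ⟪ w ⟫ → y ∈ ⟪ w ⟫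
  ∈-resp x≈y (k , eq) = k , trans (sym x≈y) eq

  ∈-respʳ : ∀ {w v x} → w ≈ v → x ∈ ⟪ w ⟫ → x ∈ ⟪ v ⟫
  ∈-respʳ w≈v (k , eq) = k , trans eq (·-congʳ k w≈v)

  ∈-ε : ∀ {w} → ε ∈ ⟪ w ⟫
  ∈-ε = 0 , refl

  ∈-∙ : ∀ {w x y} → x ∈ ⟪ w ⟫ → y ∈ ⟪ w ⟫ → x ∙ y ∈ ⟪ w ⟫
  ∈-∙ {w} (j , x≈) (k , y≈) = j + k , trans (∙-cong x≈ y≈) (sym (·-homo-+ w j k))

  ∈-· : ∀ {w x} k → x ∈ ⟪ w ⟫ → k · x ∈ ⟪ w ⟫
  ∈-· {w} k (j , x≈) = k * j , trans (·-congʳ k x≈) (·-assoc w k j)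

  ∈-multiple : ∀ {w} k → k · w ∈ ⟪ w ⟫
  ∈-multiple k = k , refl

  ∈-trans : ∀ {x y w} → x ∈ ⟪ y ⟫ → y ∈ ⟪ w ⟫ → x ∈ ⟪ w ⟫
  ∈-trans (k , x≈) y∈ = ∈-resp (sym x≈) (∈-· k y∈)

  ∈-commute : ∀ {u v w} → u ∈ ⟪ w ⟫ → v ∈ ⟪ w ⟫ → Commute u v
  ∈-commute {u} {v} {w} (j , u≈) (k , v≈) = begin
    u ∙ v         ≈⟨ ∙-cong u≈ v≈ ⟩
    j · w ∙ k · w ≈⟨ ·-homo-+ w j k ⟨
    (j + k) · w   ≈⟨ ·-cong-≡ w (ℕ.+-comm j k) ⟩
    (k + j) · w   ≈⟨ ·-homo-+ w k j ⟩
    k · w ∙ j · w ≈⟨ ∙-cong v≈ u≈ ⟨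
    v ∙ u         ∎

  -- Bézout's identity has two cases according to its sign, because all exponents are natural
  -- numbers.
  coprime-generates : ∀ {m N x} → Coprime m N → N · x ≈ ε → x ∈ ⟪ m · x ⟫
  coprime-generates {m} {N} {x} cop Nx≈ε with coprime-Bézout cop
  ... | Bézout.+- i j eq = i , (begin
    x               ≈⟨ identityʳ x ⟨
    x ∙ ε           ≈⟨ ∙-congˡ (·-kill (n∣m*n j) Nx≈ε) ⟨
    (1 + j * N) · x ≈⟨ ·-cong-≡ x eq ⟩
    (i * m) · x     ≈⟨ ·-assoc x i m ⟨
    i · (m · x)     ∎)
  coprime-generates {m} {zero}  {x} cop Nx≈ε | Bézout.-+ i j eq =
    contradiction (≡.trans eq (ℕ.*-zeroʳ j)) λ ()
  coprime-generates {m} {suc N} {x} cop Nx≈ε | Bézout.-+ i j eq =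
    -- Here x is the inverse of g, and `N · g` is that inverse because `suc N` kills g; so x is
    -- again a multiple of `m · x`.
    ∈-resp (sym (trans (inverseˡ-unique x g x∙g≈ε) (sym (inverseʳ-unique g (N · g) Ng≈ε))))
           (∈-· N (∈-resp (·-assoc x i m) (∈-multiple i)))
    where
    g = (i * m) · x
    x∙g≈ε : x ∙ g ≈ ε
    x∙g≈ε = trans (·-cong-≡ x eq) (·-kill (n∣m*n j) Nx≈ε)
    Ng≈ε : suc N · g ≈ ε
    Ng≈ε = trans (·-swap (suc N) (i * m) x) (trans (·-congʳ (i * m) Nx≈ε) (·-ε (i * m)))

  coprime-cancel : ∀ {m N x} → Coprime m N → N · x ≈ ε → m · x ≈ ε → x ≈ ε
  coprime-cancel cop Nx≈ε mx≈ε =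
    let k , x≈ = coprime-generates cop Nx≈ε
    in trans x≈ (trans (·-congʳ k mx≈ε) (·-ε k))

  module _ {p} (prime-p : Prime p) where

    prime-order-generates : ∀ {z} → p · z ≈ ε → ∀ {u} → u ∈ ⟪ z ⟫ → u ≉ ε → z ∈ ⟪ u ⟫
    prime-order-generates pz≈ε (k , u≈) u≉ε with p ∣? k
    ... | yes p∣k = contradiction (trans u≈ (·-kill p∣k pz≈ε)) u≉ε
    ... | no  p∤k = ∈-respʳ (sym u≈) (coprime-generates (prime∤⇒coprime prime-p p∤k) pz≈ε)

-- Orders of elements and Lagrange's theorem for cyclic subgroups

module FiniteGroup {c ℓ} (G : Group c ℓ) {n : ℕ} (hasOrder : HasOrder G n) where
  open Group G
  open Algebra.Properties.Group G
  open Powers G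
  open Finite setoid hasOrder public
  open ≈-Reasoning setoid

  -- The order of x, in the form in which `least` returns it.
  IsPeriod : Carrier → ℕ → Set ℓ
  IsPeriod x d = (0 < d × d · x ≈ ε) × (∀ {i} → i < d → ¬ (0 < i × i · x ≈ ε))

  abstract
    period : ∀ x → ∃[ d ] IsPeriod x d
    period x =
      let i , j , i<j , eq = collision (ℕ.n<1+n n) (λ i → toℕ i · x)
      in least (λ m → (0 ℕ.<? m) ×-dec (m · x ≟ ε))
               (ℕ.m<n⇒0<n∸m i<j , ·-difference (ℕ.<⇒≤ i<j) eq)

  module _ {x d} (isPeriod : IsPeriod x d) where
    private
      0<d     = proj₁ (proj₁ isPeriod)
      dx≈ε    = proj₂ (proj₁ isPeriod)
      minimal = proj₂ isPeriod

    period-injective : ∀ {i j} → i < d → j < d → i · x ≈ j · x → i ≡ j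
    period-injective {i} {j} i<d j<d eq with ℕ.<-cmp i j
    ... | tri≈ _ i≡j _ = i≡j
    ... | tri< i<j _ _ = contradiction
      (ℕ.m<n⇒0<n∸m i<j , ·-difference (ℕ.<⇒≤ i<j) eq)
      (minimal (ℕ.≤-<-trans (ℕ.m∸n≤m j i) j<d))
    ... | tri> _ _ j<i = contradiction
      (ℕ.m<n⇒0<n∸m j<i , ·-difference (ℕ.<⇒≤ j<i) (sym eq))
      (minimal (ℕ.≤-<-trans (ℕ.m∸n≤m i j) i<d))

    reduce : ∀ k → ∃[ i ] i < d × k · x ≈ i · x
    reduce k = k % d , m%n<n k d , (begin
      k · x                              ≈⟨ ·-cong-≡ x (m≡m%n+[m/n]*n k d) ⟩
      (k % d + (k ℕ./ d) * d) · x        ≈⟨ ·-homo-+ x (k % d) _ ⟩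
      (k % d) · x ∙ ((k ℕ./ d) * d) · x  ≈⟨ ∙-congˡ (·-kill (n∣m*n (k ℕ./ d)) dx≈ε) ⟩
      (k % d) · x ∙ ε                    ≈⟨ identityʳ _ ⟩
      (k % d) · x                        ∎)
      where instance _ = ℕ.>-nonZero 0<d

    reduceFin : ∀ {y} → y ∈ ⟪ x ⟫ → ∃[ i ] y ≈ toℕ {d} i · x
    reduceFin (k , y≈) =
      let i , i<d , eq = reduce k
      in fromℕ< i<d , trans y≈ (trans eq (·-cong-≡ x (≡.sym (Fin.toℕ-fromℕ< i<d))))

    toℕ-injective : ∀ {i j} → toℕ {d} i · x ≈ toℕ {d} j · x → i ≡ j
    toℕ-injective {i} {j} eq =
      Fin.toℕ-injective (period-injective (Fin.toℕ<n i) (Fin.toℕ<n j) eq)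

  infix 4 _∈?⟪_⟫
  _∈?⟪_⟫ : ∀ y x → Dec (y ∈ ⟪ x ⟫)
  y ∈?⟪ x ⟫ = map′ (λ (i , eq) → toℕ i , eq) (reduceFin (proj₂ (period x)))
                   (Fin.any? (λ i → y ≟ toℕ i · x))

  ∈-⁻¹ : ∀ {x w} → x ∈ ⟪ w ⟫ → x ⁻¹ ∈ ⟪ w ⟫
  ∈-⁻¹ {x} x∈ with period x
  ... | suc d , (_ , dx≈ε) , _ = ∈-resp (inverseʳ-unique x (d · x) dx≈ε) (∈-· d x∈)

  ⟪⟫⇒⟨⟩ : ∀ {x w} → x ∈ ⟪ w ⟫ → ⟨_⟩ G w x
  ⟪⟫⇒⟨⟩ (k , eq) = + k , eq

  ⟨⟩⇒⟪⟫ : ∀ {x w} → ⟨_⟩ G w x → x ∈ ⟪ w ⟫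
  ⟨⟩⇒⟪⟫ (+ k      , eq) = k , eq
  ⟨⟩⇒⟪⟫ (-[1+ k ] , eq) = ∈-resp (sym eq) (∈-⁻¹ (∈-multiple (suc k)))

  module Lagrange (x : Carrier) where
    private
      d      = proj₁ (period x)
      isPer  = proj₂ (period x)

    Coset : Carrier → Pred Carrier ℓ
    Coset h g = h \\ g ∈ ⟪ x ⟫

    coset-resp : ∀ {h} → Coset h Respects _≈_
    coset-resp g≈g′ = ∈-resp (∙-congˡ g≈g′)

    coset-sym : ∀ {g h} → Coset h g → Coset g h
    coset-sym {g} {h} g∈ = ∈-resp (⁻¹-anti-homo-\\ h g) (∈-⁻¹ g∈)

    coset-refl : ∀ {g h} → g ≈ h → Coset h g
    coset-refl {g} {h} g≈h = ∈-resp (sym (trans (∙-congˡ g≈h) (inverseˡ h))) ∈-ε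

    Disjoint : ∀ {k} → (Fin k → Carrier) → Set ℓ
    Disjoint r = ∀ {i j} → Coset (r j) (r i) → i ≡ j

    cover⇒divides : ∀ {k} (r : Fin k → Carrier) → Disjoint r →
                    (∀ g → ∃[ i ] Coset (r i) g) → d ∣ n
    cover⇒divides {k} r disjoint cover = divides k
      (card-unique {S = setoid} hasOrder (bijection⇒card setoid f f-inj f-surj))
      where
      f′ : Fin k × Fin d → Carrier
      f′ (i , j) = r i ∙ toℕ j · x

      f : Fin (k * d) → Carrier
      f = f′ ∘ Fin.remQuot d

      f′-inj : ∀ {ij ij′} → f′ ij ≈ f′ ij′ → ij ≡ ij′
      f′-inj {i , j} {i′ , j′} eq = finish (disjoint same)
        where
        same : Coset (r i′) (r i)
        same = ∈-resp (begin
          toℕ j′ · x ∙ (toℕ j · x) ⁻¹                   ≈⟨ ∙-congʳ (\\-leftDividesʳ (r i′) _) ⟨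
          (r i′ \\ (r i′ ∙ toℕ j′ · x)) ∙ (toℕ j · x) ⁻¹ ≈⟨ ∙-congʳ (∙-congˡ eq) ⟨
          (r i′ \\ (r i ∙ toℕ j · x)) ∙ (toℕ j · x) ⁻¹   ≈⟨ assoc _ _ _ ⟩
          r i′ \\ ((r i ∙ toℕ j · x) // (toℕ j · x))     ≈⟨ ∙-congˡ (//-rightDividesʳ (toℕ j · x) (r i)) ⟩
          r i′ \\ r i                                    ∎)
          (∈-∙ (∈-multiple (toℕ j′)) (∈-⁻¹ (∈-multiple (toℕ j))))
        finish : i ≡ i′ → (i , j) ≡ (i′ , j′)
        finish ≡.refl = cong (i ,_) (toℕ-injective isPer (∙-cancelˡ (r i) _ _ eq))

      f-inj : ∀ {i j} → f i ≈ f j → i ≡ j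
      f-inj {i} {j} eq = ≡.trans (≡.sym (Fin.combine-remQuot {k} d i))
        (≡.trans (cong (uncurry Fin.combine) (f′-inj eq)) (Fin.combine-remQuot {k} d j))

      f-surj : ∀ g → ∃[ i ] g ≈ f i
      f-surj g =
        let i , g∈    = cover g
            j , eq    = reduceFin isPer g∈
        in Fin.combine i j , (begin
          g                              ≈⟨ \\-leftDividesˡ (r i) g ⟨
          r i ∙ (r i \\ g)               ≈⟨ ∙-congˡ eq ⟩
          f′ (i , j)                     ≡⟨ cong f′ (Fin.remQuot-combine i j) ⟨
          f (Fin.combine i j)            ∎)

    -- Coset representatives are collected greedily. A round that fails to cover G adds a new one,
    -- and the fuel cannot run out, since n + 1 representatives of distinct cosets would be n + 1
    -- distinct elements of G.
    extend : ∀ fuel {k} → k + fuel ≡ suc n → (r : Fin k → Carrier) → Disjoint r → d ∣ n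
    extend zero {k} eq r disjoint = contradiction
      (injection⇒≤ r (disjoint ∘ coset-refl))
      (ℕ.<⇒≱ (ℕ.≤-reflexive (≡.sym (≡.trans (≡.sym (ℕ.+-identityʳ k)) eq))))
    extend (suc fuel) {k} eq r disjoint
      with ∀⊎∃¬ {P = λ g → ∃[ i ] Coset (r i) g} (λ g≈g′ (i , g∈) → i , coset-resp g≈g′ g∈)
                (λ g → Fin.any? (λ i → r i \\ g ∈?⟪ x ⟫))
    ... | inj₁ cover      = cover⇒divides r disjoint cover
    ... | inj₂ (g , g∉)   = extend fuel (≡.trans (≡.sym (ℕ.+-suc k fuel)) eq) r′ disjoint′
      where
      r′ : Fin (suc k) → Carrier
      r′ = g Vector.∷ r
      disjoint′ : Disjoint r′
      disjoint′ {Fin.zero}  {Fin.zero}  _  = ≡.refl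
      disjoint′ {Fin.zero}  {Fin.suc j} g∈ = contradiction (j , g∈) g∉
      disjoint′ {Fin.suc i} {Fin.zero}  r∈ = contradiction (i , coset-sym r∈) g∉
      disjoint′ {Fin.suc i} {Fin.suc j} r∈ = cong Fin.suc (disjoint r∈)

    period∣order : d ∣ n
    period∣order = extend (suc n) {0} ≡.refl (λ ()) λ { {()} }

  order-kills : ∀ x → n · x ≈ ε
  order-kills x = ·-kill (Lagrange.period∣order x) (proj₂ (proj₁ (proj₂ (period x))))

-- p-groups with a single subgroup of order p

module PGroup {c ℓ} (G : Group c ℓ) {p} (prime-p : Prime p) {K : ℕ}
  (hasOrder : HasOrder G (p ℕ.^ K)) (nilpotent : IsNilpotent G) where
  open Group G
  open Algebra.Properties.Group G
  open Powers G
  open FiniteGroup G hasOrder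
  open ≈-Reasoning setoid

  p-coprime : ∀ {m} → p ∤ m → Coprime m (p ℕ.^ K)
  p-coprime p∤m = coprime-^ K (prime∤⇒coprime prime-p p∤m)

  -- Normality of the cyclic subgroup of w, tested on conjugates of the generator alone, so that it
  -- is decidable.
  IsNormalElement : Pred Carrier (c ⊔ ℓ)
  IsNormalElement w = ∀ g → g \\ (w ∙ g) ∈ ⟪ w ⟫

  normal-resp : IsNormalElement Respects _≈_
  normal-resp w≈v normal g = ∈-respʳ w≈v (∈-resp (∙-congˡ (∙-congʳ w≈v)) (normal g))

  normal? : ∀ w → Dec (IsNormalElement w)
  normal? w = all? (λ g≈h → ∈-resp (\\-cong₂ g≈h (∙-congˡ g≈h))) (λ g → g \\ (w ∙ g) ∈?⟪ w ⟫)

  commutator : Carrier → Carrier → Carrier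
  commutator y g = y ⁻¹ ∙ g ⁻¹ ∙ y ∙ g

  commutator-\\ : ∀ y g → commutator y g ≈ y \\ (g \\ (y ∙ g))
  commutator-\\ y g = solve monoid

  swap-commutator : ∀ y g → y ∙ g ≈ g ∙ (y ∙ commutator y g)
  swap-commutator y g = begin
    y ∙ g                            ≈⟨ \\-leftDividesˡ g _ ⟨
    g ∙ (g \\ (y ∙ g))               ≈⟨ ∙-congˡ (\\-leftDividesˡ y _) ⟨
    g ∙ (y ∙ (y \\ (g \\ (y ∙ g))))  ≈⟨ ∙-congˡ (∙-congˡ (commutator-\\ y g)) ⟨
    g ∙ (y ∙ commutator y g)         ∎

  -- [u , y] = uᵉ, and repeated commutators with y raise u to the powers of e.
  unipotent : ∀ {i u} → UpperCentral G i u → ∀ {y e} → Coprime e (p ℕ.^ K) →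
              u ∙ y ≈ y ∙ (suc e · u) → u ≈ ε
  unipotent (trivial u≈ε) _ _ = u≈ε
  unipotent {u = u} (central [u,_]∈) {y} {e} cop eq =
    coprime-cancel cop (order-kills u) (trans (sym v≈eu)
      (unipotent ([u,_]∈ y) cop (begin
        v ∙ y               ≈⟨ ∙-congʳ v≈eu ⟩
        e · u ∙ y           ≈⟨ slide eq e ⟩
        y ∙ e · (suc e · u) ≈⟨ ∙-congˡ (·-swap e (suc e) u) ⟩
        y ∙ suc e · (e · u) ≈⟨ ∙-congˡ (·-congʳ (suc e) v≈eu) ⟨
        y ∙ suc e · v       ∎)))
    where
    v = commutator u y
    v≈eu : v ≈ e · u
    v≈eu = begin
      v                     ≈⟨ commutator-\\ u y ⟩
      u \\ (y \\ (u ∙ y))   ≈⟨ ∙-congˡ (∙-congˡ eq) ⟩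
      u \\ (y \\ (y ∙ suc e · u)) ≈⟨ ∙-congˡ (\\-leftDividesʳ y _) ⟩
      u \\ (u ∙ e · u)      ≈⟨ \\-leftDividesʳ u _ ⟩
      e · u                 ∎

  -- Moving a power of x past y multiplies its exponent by a, so collecting every y on the left
  -- leaves j times the geometric sum as exponent of x.
  power-formula : ∀ {x y a} → x ∙ y ≈ y ∙ a · x → ∀ j m →
                  m · (y ∙ j · x) ≈ m · y ∙ (geometric a m * j) · x
  power-formula eq j zero = sym (identityʳ ε)
  power-formula {x} {y} {a} eq j (suc m) = begin
    -- Peeling off the last factor instead of the first moves the accumulated power of x past a
    -- single y.
    w ∙ m · w                                 ≈⟨ slide refl m ⟨
    m · w ∙ w                                 ≈⟨ ∙-congʳ (power-formula eq j m) ⟩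
    (m · y ∙ (s * j) · x) ∙ (y ∙ j · x)       ≈⟨ regroup (m · y) ((s * j) · x) y (j · x) ⟩
    m · y ∙ ((s * j) · x ∙ y) ∙ j · x         ≈⟨ ∙-congʳ (∙-congˡ (slide eq (s * j))) ⟩
    m · y ∙ (y ∙ (s * j) · (a · x)) ∙ j · x   ≈⟨ regroup (m · y) y ((s * j) · (a · x)) (j · x) ⟨
    (m · y ∙ y) ∙ ((s * j) · (a · x) ∙ j · x) ≈⟨ ∙-cong (slide refl m) (∙-congʳ (·-assoc x (s * j) a)) ⟩
    (y ∙ m · y) ∙ ((s * j * a) · x ∙ j · x)   ≈⟨ ∙-congˡ (·-homo-+ x (s * j * a) j) ⟨
    suc m · y ∙ (s * j * a + j) · x           ≈⟨ ∙-congˡ (·-cong-≡ x (arith s j a)) ⟩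
    suc m · y ∙ ((a * s + 1) * j) · x         ∎
    where
    w = y ∙ j · x
    s = geometric a m
    regroup : ∀ a b c d → (a ∙ b) ∙ (c ∙ d) ≈ a ∙ (b ∙ c) ∙ d
    regroup a b c d = solve monoid
    arith : ∀ s j a → s * j * a + j ≡ (a * s + 1) * j
    arith = solve-∀

  conj-∙ : ∀ {x g h i j} → x ∙ g ≈ g ∙ i · x → x ∙ h ≈ h ∙ j · x →
           x ∙ (g ∙ h) ≈ (g ∙ h) ∙ (i * j) · x
  conj-∙ {x} {g} {h} {i} {j} xg xh = begin
    x ∙ (g ∙ h)             ≈⟨ assoc x g h ⟨
    (x ∙ g) ∙ h             ≈⟨ ∙-congʳ xg ⟩
    (g ∙ i · x) ∙ h         ≈⟨ assoc g _ h ⟩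
    g ∙ (i · x ∙ h)         ≈⟨ ∙-congˡ (slide xh i) ⟩
    g ∙ (h ∙ i · (j · x))   ≈⟨ assoc g h _ ⟨
    (g ∙ h) ∙ i · (j · x)   ≈⟨ ∙-congˡ (·-assoc x i j) ⟩
    (g ∙ h) ∙ (i * j) · x   ∎

  -- The hypotheses say that ⟪ z ⟫ is the only subgroup of order p.
  module UniqueSocle {z} (z≉ε : z ≉ ε) (pz≈ε : p · z ≈ ε)
                     (socle : ∀ {g} → p · g ≈ ε → g ∈ ⟪ z ⟫) where

    record MaximalNormal (x : Carrier) : Set (c ⊔ ℓ) where
      field
        normal  : IsNormalElement x
        z∈      : z ∈ ⟪ x ⟫
        maximal : ∀ {w} → IsNormalElement w → x ∈ ⟪ w ⟫ → w ∈ ⟪ x ⟫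

    z-normal : IsNormalElement z
    z-normal g = socle (∙-cancelˡ g _ _ (begin
      g ∙ p · (g \\ (z ∙ g)) ≈⟨ slide (sym (\\-leftDividesˡ g (z ∙ g))) p ⟨
      p · z ∙ g              ≈⟨ ∙-congʳ pz≈ε ⟩
      ε ∙ g                  ≈⟨ trans (identityˡ g) (sym (identityʳ g)) ⟩
      g ∙ ε                  ∎))

    -- Each strict inclusion ⟪ x ⟫ ⊂ ⟪ w ⟫ makes x a multiple of p · w, which
    -- raises the power of p needed to kill the generator.
    ascend : ∀ t s → s + t ≡ K → ∀ x → IsNormalElement x → z ∈ ⟪ x ⟫ →
             (p ℕ.^ s) · x ≉ ε → ∃ MaximalNormal
    ascend t s eq x normal z∈ px≉ε
      with any? {P = λ w → IsNormalElement w × x ∈ ⟪ w ⟫ × w ∉ ⟪ x ⟫}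
                (λ w≈v (nw , x∈ , w∉) → normal-resp w≈v nw , ∈-respʳ w≈v x∈ ,
                                        w∉ ∘ ∈-resp (sym w≈v))
                (λ w → normal? w ×-dec (x ∈?⟪ w ⟫) ×-dec ¬? (w ∈?⟪ x ⟫))
    ... | no none = x , record
      { normal  = normal
      ; z∈      = z∈
      ; maximal = λ {w} nw x∈ → decidable-stable (w ∈?⟪ x ⟫) λ w∉ → none (w , nw , x∈ , w∉)
      }
    ascend zero s eq x normal z∈ px≉ε | yes _ = contradiction
      (trans (·-cong-≡ x (cong (p ℕ.^_) (≡.trans (≡.sym (ℕ.+-identityʳ s)) eq))) (order-kills x))
      px≉ε
    ascend (suc t) s eq x normal z∈ px≉ε | yes (w , nw , (k , x≈kw) , w∉)
      with p ∣? k
    ... | no p∤k = contradiction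
      (∈-respʳ (sym x≈kw) (coprime-generates (p-coprime p∤k) (order-kills w))) w∉
    ... | yes (divides q k≡qp) =
      ascend t (suc s) (≡.trans (≡.sym (ℕ.+-suc s t)) eq) w nw
        (∈-trans z∈ (k , x≈kw)) λ pw≈ε → px≉ε (begin
          (p ℕ.^ s) · x             ≈⟨ ·-congʳ (p ℕ.^ s) x≈kw ⟩
          (p ℕ.^ s) · (k · w)       ≈⟨ ·-assoc w (p ℕ.^ s) k ⟩
          (p ℕ.^ s * k) · w       ≈⟨ ·-kill (divides q (≡.trans (cong (p ℕ.^ s *_) k≡qp) (arith (p ℕ.^ s) q p))) pw≈ε ⟩
          ε                       ∎)
      where
      arith : ∀ P q p → P * (q * p) ≡ q * (p * P)
      arith = solve-∀

    ∃maximalNormal : ∃ MaximalNormal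
    ∃maximalNormal = ascend K 0 ≡.refl z z-normal ∈-self (z≉ε ∘ trans (sym (·-homo-1 z)))

    module AtMaximal {x} (maximalNormal : MaximalNormal x) where
      open MaximalNormal maximalNormal

      x≉ε : x ≉ ε
      x≉ε x≈ε = let k , z≈ = z∈ in z≉ε (trans z≈ (trans (·-congʳ k x≈ε) (·-ε k)))

      A : Pred Carrier ℓ
      A = ⟪ x ⟫

      socle⊆A : ∀ {g} → p · g ≈ ε → g ∈ A
      socle⊆A pg≈ε = ∈-trans (socle pg≈ε) z∈

      A-cancelʳ : ∀ {y w} → y ∙ w ∈ A → w ∈ A → y ∈ A
      A-cancelʳ {y} {w} yw∈ w∈ = ∈-resp (//-rightDividesʳ w y) (∈-∙ yw∈ (∈-⁻¹ w∈))

      A-cancelˡ : ∀ {y w} → w ∙ y ∈ A → w ∈ A → y ∈ A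
      A-cancelˡ {y} {w} wy∈ w∈ = ∈-resp (\\-leftDividesʳ w y) (∈-∙ (∈-⁻¹ w∈) wy∈)

      conjʳ : ∀ g → ∃[ k ] x ∙ g ≈ g ∙ k · x
      conjʳ g = let k , eq = normal g in k , trans (sym (\\-leftDividesˡ g _)) (∙-congˡ eq)

      conjˡ : ∀ g → ∃[ k ] g ∙ x ≈ k · x ∙ g
      conjˡ g = let k , eq = conjʳ (g ⁻¹) in k , (begin
        g ∙ x                        ≈⟨ ∙-congˡ (//-rightDividesˡ g x) ⟨
        g ∙ ((x ∙ g ⁻¹) ∙ g)         ≈⟨ ∙-congˡ (∙-congʳ eq) ⟩
        g ∙ ((g ⁻¹ ∙ k · x) ∙ g)     ≈⟨ assoc g _ g ⟨
        (g ∙ (g ⁻¹ ∙ k · x)) ∙ g     ≈⟨ ∙-congʳ (\\-leftDividesˡ g _) ⟩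
        k · x ∙ g                    ∎)

      A-normal : ∀ {w} → w ∈ A → ∀ g → ∃[ v ] v ∈ A × w ∙ g ≈ g ∙ v
      A-normal (j , w≈) g =
        let k , eq = conjʳ g
        in j · (k · x) , ∈-· j (∈-multiple k) , trans (∙-congʳ w≈) (slide eq j)

      -- If p did not divide e, then e would be coprime to the order of G and `unipotent` would
      -- force x = ε.
      conj-coefficient : ∀ y → ∃[ e ] p ∣ e × x ∙ y ≈ y ∙ suc e · x
      conj-coefficient y with conjʳ y
      ... | zero , eq = contradiction
        (∙-cancelʳ y _ _ (trans eq (trans (identityʳ y) (sym (identityˡ y))))) x≉ε
      ... | suc e , eq = e , decidable-stable (p ∣? e)
        (λ p∤e → x≉ε (unipotent (proj₂ nilpotent x) (p-coprime p∤e) eq)) , eq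

      -- The coset of y is central in G / A, expressed without forming the quotient.
      CentralModA : Pred Carrier (c ⊔ ℓ)
      CentralModA y = ∀ g → ∃[ w ] w ∈ A × y ∙ g ≈ g ∙ (y ∙ w)

      ·-modA : ∀ {y w} → w ∈ A → ∀ k → ∃[ v ] v ∈ A × k · (y ∙ w) ≈ k · y ∙ v
      ·-modA w∈ zero = ε , ∈-ε , sym (identityʳ ε)
      ·-modA {y} {w} w∈ (suc k) =
        let v , v∈ , eq  = ·-modA w∈ k
            u , u∈ , eq′ = A-normal w∈ (k · y)
        in u ∙ v , ∈-∙ u∈ v∈ , (begin
          (y ∙ w) ∙ k · (y ∙ w)   ≈⟨ ∙-congˡ eq ⟩
          (y ∙ w) ∙ (k · y ∙ v)   ≈⟨ regroup y w (k · y) v ⟩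
          y ∙ (w ∙ k · y) ∙ v     ≈⟨ ∙-congʳ (∙-congˡ eq′) ⟩
          y ∙ (k · y ∙ u) ∙ v     ≈⟨ regroup y (k · y) u v ⟨
          suc k · y ∙ (u ∙ v)     ∎)
        where
        regroup : ∀ a b c d → (a ∙ b) ∙ (c ∙ d) ≈ a ∙ (b ∙ c) ∙ d
        regroup a b c d = solve monoid

      centralModA-· : ∀ {y} → CentralModA y → ∀ k → CentralModA (k · y)
      centralModA-· cen k g =
        let w , w∈ , eq  = cen g
            v , v∈ , eq′ = ·-modA w∈ k
        in v , v∈ , trans (slide eq k) (∙-congˡ eq′)

      -- The coset of y is an element of order p in the centre of G / A.
      Outer : Pred Carrier (c ⊔ ℓ)
      Outer y = y ∉ A × CentralModA y × p · y ∈ A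

      -- The predicate `N` is a property that survives the search for an outer element. It is
      -- instantiated by a trivially true property, by commuting with x, and by being a square.
      module _ {f} (N : Pred Carrier f) (N-· : ∀ {w} → N w → ∀ k → N (k · w)) where

        -- Repeated p-th powers stay central modulo A and finally enter A; the last one outside A is
        -- outer.
        climb : ∀ t {y} → (p ℕ.^ t) · y ∈ A → N y → y ∉ A → CentralModA y → ∃[ y ] N y × Outer y
        climb zero    {y} py∈ Ny y∉ cen = contradiction (∈-resp (·-homo-1 y) py∈) y∉
        climb (suc t) {y} py∈ Ny y∉ cen with p · y ∈?⟪ x ⟫
        ... | yes py∈A = y , Ny , y∉ , cen , py∈A
        ... | no  py∉A = climb t
          (∈-resp (trans (sym (·-assoc y p (p ℕ.^ t))) (·-swap p (p ℕ.^ t) y)) py∈)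
          (N-· Ny p) py∉A (centralModA-· cen p)

        power-outer : ∀ {y} → N y → y ∉ A → CentralModA y → ∃[ y ] N y × Outer y
        power-outer {y} = climb K (∈-resp (sym (order-kills y)) ∈-ε)

        module _ (N-commutator : ∀ {w} → N w → ∀ g → N (commutator w g)) where

          -- Commutators lower the index in the upper central series, so a chain of commutators
          -- outside A stops at an element all of whose commutators lie in A.
          descend : ∀ {i w} → UpperCentral G i w → N w → w ∉ A → ∃[ y ] N y × y ∉ A × CentralModA y
          descend (trivial w≈ε) _ w∉ = contradiction (∈-resp (sym w≈ε) ∈-ε) w∉
          descend {w = w} (central [w,_]∈) Nw w∉
            with ∀⊎∃¬ {P = λ g → commutator w g ∈ A}
                      (λ g≈h → ∈-resp (∙-cong (∙-congʳ (∙-congˡ (⁻¹-cong g≈h))) g≈h))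
                      (λ g → commutator w g ∈?⟪ x ⟫)
          ... | inj₁ all∈      = w , Nw , w∉ , λ g → commutator w g , all∈ g , swap-commutator w g
          ... | inj₂ (g , g∉)  = descend ([w,_]∈ g) (N-commutator Nw g) g∉

          outer : ∀ {w} → N w → w ∉ A → ∃[ y ] N y × Outer y
          outer {w} Nw w∉ =
            let y , Ny , y∉ , cen = descend (proj₂ nilpotent w) Nw w∉
            in power-outer Ny y∉ cen

      -- Since p · y cannot generate A, it is b · x with p ∣ b; replacing y by a
      -- suitable y ∙ j · x makes b divisible by ever higher powers of p, until y
      -- becomes an element of order p outside A.
      no-split : ∀ {y} → Outer y → ∀ {a t} → x ∙ y ≈ y ∙ a · x →
                 geometric a p ≡ p + p * p * t → ⊥
      no-split {y} (y∉ , cen , (b , py≈bx)) {a} {t} xy geo =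
        -- After K rounds the exponent is divisible by the group order pᴷ, so the p-th power of y′
        -- vanishes and y′ lies in the socle, hence in A.
        let y′ , y′∉ , _ , b′ , eq = improve K
        in y′∉ (socle⊆A (trans eq (·-kill (∣-trans (n∣m*n p) (m∣m*n b′)) (order-kills x))))
        where
        p∣b : p ∣ b
        p∣b with p ∣? b
        ... | yes divisible = divisible
        -- Otherwise the p-th power of y generates A, so ⟪ y ⟫ is a normal cyclic subgroup
        -- containing A, and maximality puts y into A.
        ... | no  p∤b = contradiction (maximal y-normal x∈⟪y⟫) y∉
          where
          x∈⟪y⟫ : x ∈ ⟪ y ⟫
          x∈⟪y⟫ = ∈-trans (coprime-generates (p-coprime p∤b) (order-kills x))
                          (p , sym py≈bx)
          y-normal : IsNormalElement y
          y-normal g =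
            let w , w∈ , eq = cen g
            in ∈-resp (trans (sym (\\-leftDividesʳ g _)) (∙-congˡ (sym eq)))
                      (∈-∙ ∈-self (∈-trans w∈ x∈⟪y⟫))

        improve : ∀ i → ∃[ y′ ] y′ ∉ A × x ∙ y′ ≈ y′ ∙ a · x ×
                  ∃[ b′ ] p · y′ ≈ (p ℕ.^ suc i * b′) · x
        improve zero = y , y∉ , xy , base p∣b
          where
          base : p ∣ b → ∃[ b′ ] p · y ≈ (p ℕ.^ 1 * b′) · x
          base (divides q b≡qp) = q , trans py≈bx (·-cong-≡ x (≡.trans b≡qp (arith q p)))
            where
            arith : ∀ q p → q * p ≡ p * 1 * q
            arith = solve-∀
        improve (suc i) =
          let y′ , y′∉ , xy′ , b′ , py′≈ = improve i
              P = p ℕ.^ i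
              -- Modulo the group order `d` is -1, so j stands for -pⁱb′. The leading terms cancel,
              -- and the p²t part of the geometric sum supplies the next factor p.
              d = ℕ.pred (p ℕ.^ K)
              j = d * (P * b′)
          in y′ ∙ j · x
           , (λ y′jx∈ → y′∉ (A-cancelʳ y′jx∈ (∈-multiple j)))
           , (begin
               x ∙ (y′ ∙ j · x)         ≈⟨ assoc x y′ _ ⟨
               (x ∙ y′) ∙ j · x         ≈⟨ ∙-congʳ xy′ ⟩
               (y′ ∙ a · x) ∙ j · x     ≈⟨ assoc y′ _ _ ⟩
               y′ ∙ (a · x ∙ j · x)     ≈⟨ ∙-congˡ (∈-commute (∈-multiple a) (∈-multiple j)) ⟩
               y′ ∙ (j · x ∙ a · x)     ≈⟨ assoc y′ _ _ ⟨
               (y′ ∙ j · x) ∙ a · x     ∎)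
           , t * d * b′
           , (begin
               p · (y′ ∙ j · x)
                 ≈⟨ power-formula xy′ j p ⟩
               p · y′ ∙ (geometric a p * j) · x
                 ≈⟨ ∙-cong py′≈ (·-cong-≡ x (cong (_* j) geo)) ⟩
               (p * P * b′) · x ∙ ((p + p * p * t) * j) · x
                 ≈⟨ ·-homo-+ x (p * P * b′) _ ⟨
               (p * P * b′ + (p + p * p * t) * j) · x
                 ≈⟨ ·-cong-≡ x (arith p P b′ t d) ⟩
               (P * b′ * p * suc d + p * (p * P) * (t * d * b′)) · x
                 ≈⟨ ·-homo-+ x (P * b′ * p * suc d) _ ⟩
               (P * b′ * p * suc d) · x ∙ (p ℕ.^ suc (suc i) * (t * d * b′)) · x
                 ≈⟨ ∙-congʳ (·-kill (subst (_∣ P * b′ * p * suc d) (ℕ.suc-pred (p ℕ.^ K)) (n∣m*n (P * b′ * p))) (order-kills x)) ⟩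
               ε ∙ (p ℕ.^ suc (suc i) * (t * d * b′)) · x
                 ≈⟨ identityˡ _ ⟩
               (p ℕ.^ suc (suc i) * (t * d * b′)) · x
                 ∎)
          where
          instance
            _ = prime⇒nonZero prime-p
            _ = ℕ.m^n≢0 p K
          arith : ∀ p P b t d → p * P * b + (p + p * p * t) * (d * (P * b)) ≡
                  P * b * p * suc d + p * (p * P) * (t * d * b)
          arith = solve-∀

      cyclic : (∀ g → g ∈ A) → IsCyclic G
      cyclic all∈ = x , λ g → ⟪⟫⇒⟨⟩ (all∈ g)

      -- By `geometric-odd` every coefficient 1 + pt meets the condition of `no-split`, so there is
      -- no outer element and A is all of G.
      odd⇒cyclic : ∀ h → p ≡ 1 + 2 * h → IsCyclic G
      odd⇒cyclic h p≡1+2h = cyclic λ g → decidable-stable (g ∈?⟪ x ⟫) λ g∉ →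
        let y , _ , out             = outer (λ _ → 0 ≡ 0) (λ _ _ → ≡.refl) (λ _ _ → ≡.refl) ≡.refl g∉
            e , divides t e≡tp , xy = conj-coefficient y
            u , geo                 = geometric-odd h t p≡1+2h
        in no-split out xy (≡.trans (cong (λ e → geometric (suc e) p) (≡.trans e≡tp (ℕ.*-comm t p))) geo)

-- 2-groups with a single involution

module TwoGroup {c ℓ} (G : Group c ℓ) {K : ℕ}
  (hasOrder : HasOrder G (2 ℕ.^ K)) (nilpotent : IsNilpotent G) where
  open Group G
  open Algebra.Properties.Group G
  open Powers G
  open FiniteGroup G hasOrder
  open PGroup G prime[2] {K} hasOrder nilpotent
  open ≈-Reasoning setoid

  module _ {z} (z≉ε : z ≉ ε) (2z≈ε : 2 · z ≈ ε) (socle : ∀ {g} → 2 · g ≈ ε → g ∈ ⟪ z ⟫) where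
    open UniqueSocle z≉ε 2z≈ε socle

    module _ {x} (maximalNormal : MaximalNormal x) where
      open AtMaximal maximalNormal
      open MaximalNormal maximalNormal

      involution : ∀ {g} → 2 · g ≈ ε → g ≈ ε ⊎ g ≈ z
      involution {g} 2g≈ε = case (socle 2g≈ε)
        where
        case : g ∈ ⟪ z ⟫ → g ≈ ε ⊎ g ≈ z
        case (k , g≈) with parity k
        ... | inj₁ (h , ≡.refl) = inj₁ (trans g≈ (·-kill {2} {2 * h} {z} (m∣m*n h) 2z≈ε))
        ... | inj₂ (h , ≡.refl) =
          inj₂ (trans g≈ (trans (∙-congˡ (·-kill {2} {2 * h} {z} (m∣m*n h) 2z≈ε)) (identityʳ z)))

      cancel-odd : ∀ h {g} → (1 + 2 * h) · g ≈ ε → g ≈ ε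
      cancel-odd h {g} = coprime-cancel (coprime-^ K (odd-coprime-2 h)) (order-kills g)

      2·≈∙ : ∀ g → 2 · g ≈ g ∙ g
      2·≈∙ g = ∙-congˡ (identityʳ g)

      -- An outer y acts on A by an odd exponent. If 2 killed x, then y would commute with x, and
      -- `no-split` excludes a = 1.
      2x≉ε : ∀ {y} → Outer y → 2 · x ≉ ε
      2x≉ε {y} out 2x≈ε =
        let e , divides q e≡q2 , xy = conj-coefficient y
        in no-split out {a = 1} {t = 0}
             (trans xy (∙-congˡ (∙-congˡ (·-kill (divides q e≡q2) 2x≈ε)))) ≡.refl

      -- That is, y x y⁻¹ = x⁻¹, freed of inverses.
      Inverts : Pred Carrier ℓ
      Inverts y = x ∙ (y ∙ x) ≈ y

      -- Write the coefficient as a = 1 + e with e = 2h. For even h it is 1 modulo 4 and `no-split`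
      -- applies. For odd h, e has one factor 2 only: y² is killed by 2 and, as y is outside A,
      -- equals z; and as y² commutes with x, the number a² - 1 = e (a + 1) kills x, so xᵃ⁺¹ is ε or
      -- z.
      outer-inverts : ∀ {y} → Outer y → Inverts y × 2 · y ≈ z
      outer-inverts {y} out@(y∉ , _ , b , 2y≈bx) with conj-coefficient y
      ... | e , divides h e≡h2 , xy with parity h
      ... | inj₁ (t , ≡.refl) = ⊥-elim (no-split out {suc e} {t} xy
        (≡.trans (cong (λ e → geometric (suc e) 2) e≡h2) (arith t)))
        where
        arith : ∀ t → geometric (suc (2 * t * 2)) 2 ≡ 2 + 2 * 2 * t
        arith t = go t
          where
          go : ∀ t → suc (2 * t * 2) * (suc (2 * t * 2) * 0 + 1) + 1 ≡ 2 + 2 * 2 * t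
          go = solve-∀
      ... | inj₂ (t , ≡.refl) = inverts (involution 2v≈ε) , 2y≈z (involution 2u≈ε)
        where
        a = suc e
        u = b · x
        v = suc a · x

        -- y ∙ y is a power of x fixed by y, so e kills it, where e = 2 (1 + 2t).
        uy : u ∙ y ≈ y ∙ u
        uy = trans (∙-congʳ (sym 2y≈bx)) (trans (slide refl 2) (∙-congˡ 2y≈bx))

        eu≈ε : e · u ≈ ε
        eu≈ε = identityʳ-unique u (e · u) (∙-cancelˡ y _ _ (begin
          y ∙ a · u          ≈⟨ ∙-congˡ (·-swap a b x) ⟩
          y ∙ b · (a · x)    ≈⟨ slide xy b ⟨
          u ∙ y              ≈⟨ uy ⟩
          y ∙ u              ∎))

        2u≈ε : 2 · u ≈ ε
        2u≈ε = cancel-odd t (trans (·-assoc u (1 + 2 * t) 2)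
          (trans (·-cong-≡ u (≡.sym e≡h2)) eu≈ε))

        2y≈z : u ≈ ε ⊎ u ≈ z → 2 · y ≈ z
        2y≈z (inj₁ u≈ε) = contradiction (socle⊆A (trans 2y≈bx u≈ε)) y∉
        2y≈z (inj₂ u≈z) = trans 2y≈bx u≈z

        a²x≈x : (a * a) · x ≈ x
        a²x≈x = ∙-cancelˡ (y ∙ y) _ _ (begin
          (y ∙ y) ∙ (a * a) · x ≈⟨ conj-∙ {i = a} {j = a} xy xy ⟨
          x ∙ (y ∙ y)           ≈⟨ ∙-congˡ (2·≈∙ y) ⟨
          x ∙ 2 · y             ≈⟨ ∈-commute ∈-self (b , 2y≈bx) ⟩
          2 · y ∙ x             ≈⟨ ∙-congʳ (2·≈∙ y) ⟩
          (y ∙ y) ∙ x           ∎)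

        2v≈ε : 2 · v ≈ ε
        2v≈ε = cancel-odd t (begin
          (1 + 2 * t) · (2 · v)                       ≈⟨ ·-congʳ (1 + 2 * t) (·-assoc x 2 (suc a)) ⟩
          (1 + 2 * t) · ((2 * suc a) · x)             ≈⟨ ·-assoc x (1 + 2 * t) (2 * suc a) ⟩
          ((1 + 2 * t) * (2 * suc a)) · x             ≈⟨ ·-cong-≡ x (≡.trans (reassoc t a) (cong (_* suc a) (≡.sym e≡h2))) ⟩
          (e * suc a) · x                             ≈⟨ identityʳ-unique x _ (trans (·-cong-≡ x (arith e)) a²x≈x) ⟩
          ε                                           ∎)
          where
          reassoc : ∀ t a → (1 + 2 * t) * (2 * suc a) ≡ (1 + 2 * t) * 2 * suc a
          reassoc = solve-∀
          arith : ∀ e → suc (e * suc (suc e)) ≡ suc e * suc e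
          arith = solve-∀

        inverts : v ≈ ε ⊎ v ≈ z → Inverts y
        inverts (inj₁ v≈ε) = begin
          x ∙ (y ∙ x)     ≈⟨ assoc x y x ⟨
          (x ∙ y) ∙ x     ≈⟨ ∙-congʳ xy ⟩
          (y ∙ a · x) ∙ x ≈⟨ assoc y _ x ⟩
          y ∙ (a · x ∙ x) ≈⟨ ∙-congˡ (slide refl a) ⟩
          y ∙ v           ≈⟨ ∙-congˡ v≈ε ⟩
          y ∙ ε           ≈⟨ identityʳ y ⟩
          y               ∎
        -- In this case (y x)² = y² xᵃ⁺¹ = z z = ε, which would put y x, and with it y, into A.
        inverts (inj₂ v≈z) = contradiction (A-cancelʳ (socle⊆A (begin
          2 · (y ∙ 1 · x)                     ≈⟨ power-formula {a = a} xy 1 2 ⟩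
          2 · y ∙ (geometric a 2 * 1) · x     ≈⟨ ∙-cong (2y≈z (involution 2u≈ε)) (·-cong-≡ x (arith a)) ⟩
          z ∙ v                               ≈⟨ ∙-congˡ v≈z ⟩
          z ∙ z                               ≈⟨ 2·≈∙ z ⟨
          2 · z                               ≈⟨ 2z≈ε ⟩
          ε                                   ∎)) (∈-multiple 1)) y∉
          where
          arith : ∀ a → (a * (a * 0 + 1) + 1) * 1 ≡ suc a
          arith = solve-∀

      -- A is normal, hence so is its centralizer, which therefore contains the commutators of its
      -- elements. This makes commuting with x an admissible `N`.
      x-commutator : ∀ {w} → Commute x w → ∀ g → Commute x (commutator w g)
      x-commutator {w} xw g = begin
        x ∙ commutator w g       ≈⟨ ∙-congˡ (commutator-\\ w g) ⟩
        x ∙ (w \\ u)             ≈⟨ ∙-cancelˡ w _ _ (begin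
          w ∙ (x ∙ (w \\ u))       ≈⟨ assoc w x _ ⟨
          (w ∙ x) ∙ (w \\ u)       ≈⟨ ∙-congʳ xw ⟨
          (x ∙ w) ∙ (w \\ u)       ≈⟨ assoc x w _ ⟩
          x ∙ (w ∙ (w \\ u))       ≈⟨ ∙-congˡ (\\-leftDividesˡ w u) ⟩
          x ∙ u                    ≈⟨ xu ⟩
          u ∙ x                    ≈⟨ ∙-congʳ (\\-leftDividesˡ w u) ⟨
          (w ∙ (w \\ u)) ∙ x       ≈⟨ assoc w _ x ⟩
          w ∙ ((w \\ u) ∙ x)       ∎) ⟩
        (w \\ u) ∙ x             ≈⟨ ∙-congʳ (commutator-\\ w g) ⟨
        commutator w g ∙ x       ∎
        where
        u = g \\ (w ∙ g)
        gu≈wg : g ∙ u ≈ w ∙ g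
        gu≈wg = \\-leftDividesˡ g (w ∙ g)
        xu : x ∙ u ≈ u ∙ x
        xu = let k , gx = conjˡ g in ∙-cancelˡ g _ _ (begin
          g ∙ (x ∙ u)        ≈⟨ assoc g x u ⟨
          (g ∙ x) ∙ u        ≈⟨ ∙-congʳ gx ⟩
          (k · x ∙ g) ∙ u    ≈⟨ assoc _ g u ⟩
          k · x ∙ (g ∙ u)    ≈⟨ ∙-congˡ gu≈wg ⟩
          k · x ∙ (w ∙ g)    ≈⟨ assoc _ w g ⟨
          (k · x ∙ w) ∙ g    ≈⟨ ∙-congʳ (·-commute xw k) ⟩
          (w ∙ k · x) ∙ g    ≈⟨ assoc w _ g ⟩
          w ∙ (k · x ∙ g)    ≈⟨ ∙-congˡ gx ⟨
          w ∙ (g ∙ x)        ≈⟨ assoc w g x ⟨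
          (w ∙ g) ∙ x        ≈⟨ ∙-congʳ gu≈wg ⟨
          (g ∙ u) ∙ x        ≈⟨ assoc g u x ⟩
          g ∙ (u ∙ x)        ∎)

      -- Otherwise the search would end at an outer y commuting with x, which `no-split` excludes
      -- with a = 1.
      centralizer⊆A : ∀ {g} → Commute x g → g ∈ A
      centralizer⊆A {g} xg = decidable-stable (g ∈?⟪ x ⟫) λ g∉ →
        let y , xy , out = outer (Commute x) (λ xw k → sym (slide (sym xw) k)) x-commutator xg g∉
        in no-split out {a = 1} {t = 0} (trans xy (∙-congˡ (sym (·-homo-1 x)))) ≡.refl

      -- G / A acts faithfully on A through the abelian group Aut A.
      all-central : ∀ g → CentralModA g
      all-central g h = v , centralizer⊆A (∙-cancelˡ H _ _ (begin
          H ∙ (x ∙ v)           ≈⟨ assoc H x v ⟨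
          (H ∙ x) ∙ v           ≈⟨ ∙-congʳ Hx ⟩
          (m · x ∙ H) ∙ v       ≈⟨ assoc _ H v ⟩
          m · x ∙ (H ∙ v)       ≈⟨ ∙-congˡ gh≈Hv ⟨
          m · x ∙ (g ∙ h)       ≈⟨ ghx ⟨
          (g ∙ h) ∙ x           ≈⟨ ∙-congʳ gh≈Hv ⟩
          (H ∙ v) ∙ x           ≈⟨ assoc H v x ⟩
          H ∙ (v ∙ x)           ∎)) , swap-commutator g h
        where
        v = commutator g h
        H = h ∙ g
        i = proj₁ (conjˡ g)
        j = proj₁ (conjˡ h)
        m = j * i
        conjˡ-∙ : ∀ {g h i j} → g ∙ x ≈ i · x ∙ g → h ∙ x ≈ j · x ∙ h →
                  (g ∙ h) ∙ x ≈ (j * i) · x ∙ (g ∙ h)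
        conjˡ-∙ {g} {h} {i} {j} gx hx = begin
          (g ∙ h) ∙ x              ≈⟨ assoc g h x ⟩
          g ∙ (h ∙ x)              ≈⟨ ∙-congˡ hx ⟩
          g ∙ (j · x ∙ h)          ≈⟨ assoc g _ h ⟨
          (g ∙ j · x) ∙ h          ≈⟨ ∙-congʳ (slide (sym gx) j) ⟨
          (j · (i · x) ∙ g) ∙ h    ≈⟨ assoc _ g h ⟩
          j · (i · x) ∙ (g ∙ h)    ≈⟨ ∙-congʳ (·-assoc x j i) ⟩
          (j * i) · x ∙ (g ∙ h)    ∎
        gh≈Hv : g ∙ h ≈ H ∙ v
        gh≈Hv = trans (swap-commutator g h) (sym (assoc h g v))
        ghx : (g ∙ h) ∙ x ≈ m · x ∙ (g ∙ h)
        ghx = conjˡ-∙ {i = i} {j = j} (proj₂ (conjˡ g)) (proj₂ (conjˡ h))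
        Hx : H ∙ x ≈ m · x ∙ H
        Hx = trans (conjˡ-∙ {i = j} {j = i} (proj₂ (conjˡ h)) (proj₂ (conjˡ g)))
                   (∙-congʳ (·-cong-≡ x (ℕ.*-comm i j)))

      -- An h with h² acting as inversion would give c² ≡ -1 modulo the order of x,
      -- which is divisible by 4.
      square∈A : ∀ g → 2 · g ∈ A
      square∈A g = decidable-stable (2 · g ∈?⟪ x ⟫) λ 2g∉ →
        let y , (h , y≈2h) , out = power-outer (λ y → ∃[ h ] y ≈ 2 · h)
              (λ (h , w≈2h) k → k · h , trans (·-congʳ k w≈2h) (·-swap k 2 h))
              (g , refl) 2g∉ (all-central (2 · g))
        in no-root out y≈2h
        where
        no-root : ∀ {y h} → Outer y → y ≈ 2 · h → ⊥
        no-root {y} {h} out y≈2h = case (parity k)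
          where
          k = proj₁ (conjʳ h)
          killed : suc (k * k) · x ≈ ε
          killed = trans (sym (slide refl (k * k))) (identityʳ-unique y _ (begin
            y ∙ ((k * k) · x ∙ x)     ≈⟨ assoc y _ x ⟨
            (y ∙ (k * k) · x) ∙ x     ≈⟨ ∙-congʳ (∙-congʳ (trans y≈2h (2·≈∙ h))) ⟩
            ((h ∙ h) ∙ (k * k) · x) ∙ x ≈⟨ ∙-congʳ (conj-∙ {i = k} {j = k} (proj₂ (conjʳ h)) (proj₂ (conjʳ h))) ⟨
            (x ∙ (h ∙ h)) ∙ x         ≈⟨ ∙-congʳ (∙-congˡ (trans y≈2h (2·≈∙ h))) ⟨
            (x ∙ y) ∙ x               ≈⟨ assoc x y x ⟩
            x ∙ (y ∙ x)               ≈⟨ proj₁ (outer-inverts out) ⟩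
            y                         ∎))
          case : (∃[ f ] k ≡ 2 * f) ⊎ (∃[ f ] k ≡ 1 + 2 * f) → ⊥
          case (inj₁ (f , k≡)) = x≉ε (cancel-odd (2 * (f * f))
            (trans (·-cong-≡ x (≡.sym (≡.trans (cong (λ k → suc (k * k)) k≡) (arith f)))) killed))
            where
            arith : ∀ f → suc (2 * f * (2 * f)) ≡ 1 + 2 * (2 * (f * f))
            arith = solve-∀
          -- For odd k the number k² + 1 is twice an odd one, so already 2 kills x.
          case (inj₂ (f , k≡)) = 2x≉ε out (cancel-odd (f + f * f) (trans
            (·-assoc x (1 + 2 * (f + f * f)) 2)
            (trans (·-cong-≡ x (≡.sym (≡.trans (cong (λ k → suc (k * k)) k≡) (arith f)))) killed)))
            where
            arith : ∀ f → suc ((1 + 2 * f) * (1 + 2 * f)) ≡ (1 + 2 * (f + f * f)) * 2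
            arith = solve-∀

      module _ {y} (y∉ : y ∉ A) where

        ∉⇒outer : ∀ {g} → g ∉ A → Outer g
        ∉⇒outer {g} g∉ = g∉ , all-central g , square∈A g

        y-inverts : Inverts y
        y-inverts = proj₁ (outer-inverts (∉⇒outer y∉))

        -- A product of two elements that invert x centralizes x, so y g lies in A for g outside A;
        -- since y² lies there too, A has index 2.
        cosets : ∀ g → g ∈ A ⊎ y \\ g ∈ A
        cosets g with g ∈?⟪ x ⟫
        ... | yes g∈ = inj₁ g∈
        ... | no  g∉ = inj₂ (A-cancelˡ (∈-resp (begin
          y ∙ g                      ≈⟨ ∙-congˡ (\\-leftDividesˡ y g) ⟨
          y ∙ (y ∙ (y \\ g))         ≈⟨ assoc y y _ ⟨
          (y ∙ y) ∙ (y \\ g)         ≈⟨ ∙-congʳ (2·≈∙ y) ⟨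
          2 · y ∙ (y \\ g)           ∎) yg∈) (square∈A y))
          where
          g-inverts = proj₁ (outer-inverts (∉⇒outer g∉))
          yg∈ : y ∙ g ∈ A
          yg∈ = centralizer⊆A (begin
            x ∙ (y ∙ g)                ≈⟨ ∙-congˡ (∙-congˡ g-inverts) ⟨
            x ∙ (y ∙ (x ∙ (g ∙ x)))    ≈⟨ ∙-congˡ (assoc y x _) ⟨
            x ∙ ((y ∙ x) ∙ (g ∙ x))    ≈⟨ assoc x _ _ ⟨
            (x ∙ (y ∙ x)) ∙ (g ∙ x)    ≈⟨ ∙-congʳ y-inverts ⟩
            y ∙ (g ∙ x)                ≈⟨ assoc y g x ⟨
            (y ∙ g) ∙ x                ∎)

        module _ {d} (isPeriod : IsPeriod x d) where

          order-2d : HasOrder G (2 * d)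
          order-2d = bijection⇒card setoid f f-inj f-surj
            where
            f′ : Fin 2 × Fin d → Carrier
            f′ (Fin.zero         , j) = toℕ j · x
            f′ (Fin.suc Fin.zero , j) = y ∙ toℕ j · x

            f : Fin (2 * d) → Carrier
            f = f′ ∘ Fin.remQuot d

            f′-inj : ∀ {i j} → f′ i ≈ f′ j → i ≡ j
            f′-inj {Fin.zero , i}         {Fin.zero , j}         eq =
              cong (Fin.zero ,_) (toℕ-injective isPeriod eq)
            f′-inj {Fin.zero , i}         {Fin.suc Fin.zero , j} eq =
              contradiction (A-cancelʳ (∈-resp eq (∈-multiple (toℕ i))) (∈-multiple (toℕ j))) y∉
            f′-inj {Fin.suc Fin.zero , i} {Fin.zero , j}         eq =
              contradiction (A-cancelʳ (∈-resp (sym eq) (∈-multiple (toℕ j))) (∈-multiple (toℕ i))) y∉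
            f′-inj {Fin.suc Fin.zero , i} {Fin.suc Fin.zero , j} eq =
              cong (Fin.suc Fin.zero ,_) (toℕ-injective isPeriod (∙-cancelˡ y _ _ eq))

            f-inj : ∀ {i j} → f i ≈ f j → i ≡ j
            f-inj {i} {j} eq = ≡.trans (≡.sym (Fin.combine-remQuot {2} d i))
              (≡.trans (cong (uncurry Fin.combine) (f′-inj {Fin.remQuot d i} {Fin.remQuot d j} eq)) (Fin.combine-remQuot {2} d j))

            f′-surj : ∀ g → ∃[ i ] g ≈ f′ i
            f′-surj g with cosets g
            ... | inj₁ g∈ = let j , eq = reduceFin isPeriod g∈ in (Fin.zero , j) , eq
            ... | inj₂ g∈ = let j , eq = reduceFin isPeriod g∈ in
              (Fin.suc Fin.zero , j) , trans (sym (\\-leftDividesˡ y g)) (∙-congˡ eq)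

            f-surj : ∀ g → ∃[ i ] g ≈ f i
            f-surj g = let (i , j) , eq = f′-surj g in
              Fin.combine i j , trans eq (reflexive (≡.sym (cong f′ (Fin.remQuot-combine i j))))

          -- The exponent is a variable equal to `K` to allow a case distinction. As d is half the
          -- group order, the orders 1, 2 and 4 would trivialize z, x and `2 · x` in turn.
          generalizedQuaternion : ∀ {k} → k ≡ K → 2 ℕ.^ k ≡ 2 * d → IsGeneralizedQuaternion G
          generalizedQuaternion {0} ≡.refl _ =
            contradiction (trans (sym (·-homo-1 z)) (order-kills z)) z≉ε
          generalizedQuaternion {suc k} k≡K 2^k≡2d with ℕ.*-cancelˡ-≡ (2 ℕ.^ k) d 2 2^k≡2d
          generalizedQuaternion {1} k≡K _ | ≡.refl =
            contradiction (trans (sym (·-homo-1 x)) (proj₂ (proj₁ isPeriod))) x≉ε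
          generalizedQuaternion {2} k≡K _ | ≡.refl =
            contradiction (proj₂ (proj₁ isPeriod)) (2x≉ε (∉⇒outer y∉))
          generalizedQuaternion {suc (suc (suc k))} ≡.refl _ | ≡.refl =
            3 + k , s≤s (s≤s (s≤s z≤n)) , hasOrder , x , y
            , generates , proj₂ (proj₁ isPeriod) , half≈2y , y-conjugates
            where
            powers : ∀ j → j · x ∈ Generated G (λ w → w ≈ x ⊎ w ≈ y)
            powers zero    = gen-ε
            powers (suc j) = gen-∙ (gen (inj₁ refl)) (powers j)

            generates : ∀ g → g ∈ Generated G (λ w → w ≈ x ⊎ w ≈ y)
            generates g with cosets g
            ... | inj₁ (j , eq) = gen-resp (sym eq) (powers j)
            ... | inj₂ (j , eq) =
              gen-resp (trans (∙-congˡ (sym eq)) (\\-leftDividesˡ y g))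
                       (gen-∙ (gen (inj₂ refl)) (powers j))

            half = 2 ℕ.^ (1 + k)

            half≈2y : half · x ≈ 2 · y
            -- The square of `half · x` is ε, so it is ε or z. The minimality of d rules out ε, and
            -- y² is z as well.
            half≈2y with involution {half · x} (trans (·-assoc x 2 half) (proj₂ (proj₁ isPeriod)))
            ... | inj₂ half≈z = trans half≈z (sym (proj₂ (outer-inverts (∉⇒outer y∉))))
            ... | inj₁ half≈ε = contradiction (ℕ.m^n>0 2 (1 + k) , half≈ε)
              (proj₂ isPeriod (ℕ.^-monoʳ-< 2 (s≤s (s≤s z≤n)) (ℕ.n<1+n (1 + k))))

            y-conjugates : y ∙ x ∙ y ⁻¹ ≈ x ⁻¹
            y-conjugates = trans (∙-congʳ (y≈x\\z x (y ∙ x) y y-inverts)) (//-rightDividesʳ y (x ⁻¹))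

      cyclic⊎quaternion : IsCyclic G ⊎ IsGeneralizedQuaternion G
      cyclic⊎quaternion with ∀⊎∃¬ ∈-resp (_∈?⟪ x ⟫)
      ... | inj₁ all∈     = inj₁ (cyclic all∈)
      ... | inj₂ (y , y∉) = inj₂ (generalizedQuaternion y∉ (proj₂ (period x)) ≡.refl
        (card-unique {S = setoid} hasOrder (order-2d y∉ (proj₂ (period x)))))

module _ {c ℓ} (G : Group c ℓ) where
  open Group G
  open Powers G

  unique-socle⇒cyclic⊎quaternion : ∀ {p} → Prime p → ∀ {K} →
    HasOrder G (p ℕ.^ K) → IsNilpotent G →
    ∀ {z} → z ≉ ε → p · z ≈ ε → (∀ {g} → p · g ≈ ε → g ∈ ⟪ z ⟫) →
    IsCyclic G ⊎ IsGeneralizedQuaternion G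
  unique-socle⇒cyclic⊎quaternion {p} prime-p {K} hasOrder nilpotent z≉ε pz≈ε socle with parity p
  ... | inj₂ (h , p≡1+2h) =
    inj₁ (PGroup.UniqueSocle.AtMaximal.odd⇒cyclic G prime-p {K} hasOrder nilpotent z≉ε pz≈ε socle
      (proj₂ (PGroup.UniqueSocle.∃maximalNormal G prime-p {K} hasOrder nilpotent z≉ε pz≈ε socle))
      h p≡1+2h)
  ... | inj₁ (h , p≡2h)
    with prime⇒irreducible prime-p (divides h (≡.trans p≡2h (ℕ.*-comm 2 h)))
  ...   | inj₂ ≡.refl =
    TwoGroup.cyclic⊎quaternion G {K} hasOrder nilpotent z≉ε pz≈ε socle
      (proj₂ (PGroup.UniqueSocle.∃maximalNormal G prime[2] {K} hasOrder nilpotent z≉ε pz≈ε socle))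

-- Subgroups of prime order

module PrimeOrder {c ℓ} (G : Group c ℓ) {n} (hasOrder : HasOrder G n) where
  open Group G
  open Algebra.Properties.Group G
  open Powers G
  open FiniteGroup G hasOrder
  open Subgroup using (member; group; resp; ε-closed; ∙-closed; ⁻¹-closed)
  open ≈-Reasoning setoid

  period-divides : ∀ {x d} → IsPeriod x d → ∀ {k} → k · x ≈ ε → d ∣ k
  period-divides {x} {d} isPeriod@((0<d , _) , minimal) {k} kx≈ε =
    m%n≡0⇒n∣m k d (period-injective isPeriod (m%n<n k d) 0<d
      (trans (sym (proj₂ (proj₂ (reduce isPeriod k)))) kx≈ε))
    where instance _ = ℕ.>-nonZero 0<d

  prime-period : ∀ {p} → Prime p → ∀ {g} → g ≉ ε → p · g ≈ ε → IsPeriod g p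
  prime-period prime-p g≉ε pg≈ε =
    (ℕ.>-nonZero⁻¹ _ , pg≈ε) , λ i<p (0<i , ig≈ε) →
      g≉ε (coprime-cancel (Coprime.sym (prime⇒coprime prime-p {{ℕ.>-nonZero 0<i}} i<p)) pg≈ε ig≈ε)
    where instance _ = prime⇒nonZero prime-p

  -- If p does not divide the order d of w, then p · a = ε forces a = ε. If d = qp, both elements
  -- lie in the group generated by `q · w`, which p kills, so each nontrivial element generates it.
  same-subgroup : ∀ {p} → Prime p → ∀ {a b w} → a ≉ ε → b ≉ ε → p · a ≈ ε → p · b ≈ ε →
                  a ∈ ⟪ w ⟫ → b ∈ ⟪ w ⟫ → a ∈ ⟪ b ⟫
  same-subgroup {p} prime-p {a} {b} {w} a≉ε b≉ε pa≈ε pb≈ε a∈@(i , a≈) b∈ = case (p ∣? d)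
    where
    d = proj₁ (period w)
    isPeriod = proj₂ (period w)
    instance _ = prime⇒nonZero prime-p

    d∣p* : ∀ {a} → p · a ≈ ε → ((i , _) : a ∈ ⟪ w ⟫) → d ∣ p * i
    d∣p* pa≈ε (i , a≈) =
      period-divides isPeriod (trans (sym (·-assoc w p i)) (trans (·-congʳ p (sym a≈)) pa≈ε))

    case : Dec (p ∣ d) → a ∈ ⟪ b ⟫
    case (no p∤d) = contradiction
      (trans a≈ (·-kill (coprime-divisor (prime∤⇒coprime prime-p p∤d) (d∣p* pa≈ε a∈))
                        (proj₂ (proj₁ isPeriod)))) a≉ε
    case (yes (divides q d≡qp)) =
      ∈-trans (∈⟪qw⟫ pa≈ε a∈) (prime-order-generates prime-p p·qw≈ε (∈⟪qw⟫ pb≈ε b∈) b≉ε)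
      where
      d≡pq = ≡.trans d≡qp (ℕ.*-comm q p)
      p·qw≈ε : p · (q · w) ≈ ε
      p·qw≈ε = trans (·-assoc w p q) (trans (·-cong-≡ w (≡.sym d≡pq)) (proj₂ (proj₁ isPeriod)))
      ∈⟪qw⟫ : ∀ {a} → p · a ≈ ε → a ∈ ⟪ w ⟫ → a ∈ ⟪ q · w ⟫
      ∈⟪qw⟫ pa≈ε a∈@(i , a≈)
        with divides j i≡jq ← *-cancelˡ-∣ p (subst (_∣ p * i) d≡pq (d∣p* pa≈ε a∈)) =
        j , trans a≈ (trans (·-cong-≡ w i≡jq) (sym (·-assoc w j q)))

  module _ (P : Subgroup G) where
    private module P = Powers (group P)

    ·-proj₁ : ∀ k h → proj₁ (k P.· h) ≡ k · proj₁ h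
    ·-proj₁ zero    h = ≡.refl
    ·-proj₁ (suc k) h = cong (proj₁ h ∙_) (·-proj₁ k h)

    ·-closed : ∀ {g} → g ∈ member P → ∀ k → k · g ∈ member P
    ·-closed g∈ zero    = ε-closed P
    ·-closed g∈ (suc k) = ∙-closed P g∈ (·-closed g∈ k)

    ⟪⟫-closed : ∀ {g h} → g ∈ member P → h ∈ ⟪ g ⟫ → h ∈ member P
    ⟪⟫-closed g∈ (k , h≈) = resp P (sym h≈) (·-closed g∈ k)

    subgroup-kills : ∀ {k} → HasOrder (group P) k → ∀ {g} → g ∈ member P → k · g ≈ ε
    subgroup-kills {k} orderP {g} g∈ =
      trans (reflexive (≡.sym (·-proj₁ k (g , g∈)))) (FiniteGroup.order-kills (group P) orderP (g , g∈))

    subgroup-nontrivial : ∀ {k} → 1 < k → HasOrder (group P) k → ∃[ g ] g ∈ member P × g ≉ ε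
    subgroup-nontrivial {1} (s≤s ()) _
    subgroup-nontrivial {suc (suc k)} _ orderP with proj₁ (Inverse.from orderP Fin.zero) ≟ ε
    ... | no  g≉ε = _ , proj₂ (Inverse.from orderP Fin.zero) , g≉ε
    ... | yes g≈ε = _ , proj₂ (Inverse.from orderP (Fin.suc Fin.zero)) , λ h≈ε →
      contradiction (≡.trans (≡.sym (Inverse.strictlyInverseˡ orderP _))
        (≡.trans (Inverse.to-cong orderP (trans g≈ε (sym h≈ε)))
                 (Inverse.strictlyInverseˡ orderP _))) λ ()

    -- Otherwise h and the p multiples of g would be p + 1 distinct elements.
    prime-order⇒cyclic : ∀ {p} → Prime p → HasOrder (group P) p →
                         ∀ {g h} → g ∈ member P → g ≉ ε → h ∈ member P → h ∈ ⟪ g ⟫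
    prime-order⇒cyclic {p} prime-p orderP {g} {h} g∈ g≉ε h∈ =
      decidable-stable (h ∈?⟪ g ⟫) λ h∉ →
        contradiction (Finite.injection⇒≤ (Group.setoid (group P)) orderP f
          λ {i} {j} → f-inj h∉ {i} {j}) (ℕ.<⇒≱ (ℕ.n<1+n p))
      where
      isPeriod = prime-period prime-p g≉ε (subgroup-kills orderP g∈)
      f : Fin (suc p) → Group.Carrier (group P)
      f = (h , h∈) Vector.∷ λ j → toℕ j · g , ·-closed g∈ (toℕ j)
      f-inj : h ∉ ⟪ g ⟫ → ∀ {i j} → proj₁ (f i) ≈ proj₁ (f j) → i ≡ j
      f-inj h∉ {Fin.zero}  {Fin.zero}  _  = ≡.refl
      f-inj h∉ {Fin.zero}  {Fin.suc j} eq = contradiction (toℕ j , eq) h∉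
      f-inj h∉ {Fin.suc i} {Fin.zero}  eq = contradiction (toℕ i , sym eq) h∉
      f-inj h∉ {Fin.suc i} {Fin.suc j} eq = cong Fin.suc (toℕ-injective isPeriod eq)

  cyclicSubgroup : Carrier → Subgroup G
  cyclicSubgroup g = record
    { member    = ⟪ g ⟫
    ; resp      = ∈-resp
    ; ε-closed  = ∈-ε
    ; ∙-closed  = ∈-∙
    ; ⁻¹-closed = ∈-⁻¹
    }

  cyclicSubgroup-order : ∀ {g d} → IsPeriod g d → HasOrder (group (cyclicSubgroup g)) d
  cyclicSubgroup-order {g} isPeriod =
    bijection⇒card (Group.setoid (group (cyclicSubgroup g)))
      (λ j → toℕ j · g , ∈-multiple (toℕ j))
      (toℕ-injective isPeriod)
      (λ (h , h∈) → reduceFin isPeriod h∈)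

  -- One chosen generator for each of the r subgroups of order p, so that the counting handles
  -- elements in place of subgroups.
  record PrimeOrderGenerators (P : Subgroup G) (p r : ℕ) : Set (c ⊔ ℓ) where
    field
      atom      : Fin r → Carrier
      atom∈     : ∀ j → atom j ∈ member P
      atom≉ε    : ∀ j → atom j ≉ ε
      p·atom≈ε  : ∀ j → p · atom j ≈ ε
      distinct : ∀ {i j} → atom i ∈ ⟪ atom j ⟫ → i ≡ j
      complete : ∀ {g} → g ∈ member P → g ≉ ε → p · g ≈ ε → ∃[ j ] atom j ∈ ⟪ g ⟫

  primeOrderGenerators : ∀ {p} → Prime p → ∀ P {r} →
    HasCardinality (subgroupsOfOrderIn {G = G} p P) r → PrimeOrderGenerators P p r
  primeOrderGenerators {p} prime-p P {r} card = record
    { atom      = atom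
    ; atom∈     = λ j → proj₁ (proj₂ (from j)) (atom∈H j)
    ; atom≉ε    = atom≉ε
    ; p·atom≈ε  = p·atom≈ε
    ; distinct = λ {i} {j} gi∈ → ≡.trans (≡.sym (strictlyInverseˡ i))
        (≡.trans (to-cong (H⊆H gi∈ , H⊆H (prime-order-generates prime-p (p·atom≈ε j) gi∈ (atom≉ε i))))
                 (strictlyInverseˡ j))
    ; complete = λ {g} g∈ g≉ε pg≈ε →
        let K : Setoid.Carrier (subgroupsOfOrderIn {G = G} p P)
            K = cyclicSubgroup g , ⟪⟫-closed P g∈ ,
                cyclicSubgroup-order (prime-period prime-p g≉ε pg≈ε)
        in to K , proj₁ (strictlyInverseʳ K) (atom∈H (to K))
    }
    where
    open Inverse card
    H : Fin r → Subgroup G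
    H j = proj₁ (from j)
    orderH : ∀ j → HasOrder (group (H j)) p
    orderH j = proj₂ (proj₂ (from j))
    nontrivial : ∀ j → ∃[ g ] g ∈ member (H j) × g ≉ ε
    nontrivial j = subgroup-nontrivial (H j) (ℕ.nonTrivial⇒n>1 p {{prime⇒nonTrivial prime-p}}) (orderH j)
    atom : Fin r → Carrier
    atom j = proj₁ (nontrivial j)
    atom∈H : ∀ j → atom j ∈ member (H j)
    atom∈H j = proj₁ (proj₂ (nontrivial j))
    atom≉ε : ∀ j → atom j ≉ ε
    atom≉ε j = proj₂ (proj₂ (nontrivial j))
    p·atom≈ε : ∀ j → p · atom j ≈ ε
    p·atom≈ε j = subgroup-kills (H j) (orderH j) (atom∈H j)
    H⊆H : ∀ {i j} → atom i ∈ ⟪ atom j ⟫ → ∀ {h} → h ∈ member (H i) → h ∈ member (H j)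
    H⊆H {i} {j} gi∈ h∈ = ⟪⟫-closed (H j) (atom∈H j)
      (∈-trans (prime-order⇒cyclic (H i) prime-p (orderH i) (atom∈H i) (atom≉ε i) h∈) gi∈)

  module PrimePowerSubgroup (P : Subgroup G) {p k r} (prime-p : Prime p)
    (orderP : HasOrder (group P) (p ℕ.^ k)) (atoms : PrimeOrderGenerators P p r) where
    open PrimeOrderGenerators atoms

    order-p-multiple : ∀ t {g} → g ≉ ε → (p ℕ.^ t) · g ≈ ε → ∃[ u ] u ∈ ⟪ g ⟫ × u ≉ ε × p · u ≈ ε
    order-p-multiple zero    {g} g≉ε g≈ε = contradiction (trans (sym (·-homo-1 g)) g≈ε) g≉ε
    order-p-multiple (suc t) {g} g≉ε eq with p · g ≟ ε
    ... | yes pg≈ε = g , ∈-self , g≉ε , pg≈ε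
    ... | no  pg≉ε =
      let u , u∈ , rest = order-p-multiple t pg≉ε
            (trans (·-swap (p ℕ.^ t) p g) (trans (·-assoc g p (p ℕ.^ t)) eq))
      in u , ∈-trans u∈ (∈-multiple p) , rest

    atom-below : ∀ {g} → g ∈ member P → g ≉ ε → ∃[ j ] atom j ∈ ⟪ g ⟫
    atom-below g∈ g≉ε =
      let u , u∈ , u≉ε , pu≈ε = order-p-multiple k g≉ε (subgroup-kills P orderP g∈)
          j , gj∈             = complete (⟪⟫-closed P g∈ u∈) u≉ε pu≈ε
      in j , ∈-trans gj∈ u∈

    -- A cyclic group has at most one subgroup of order p. With `atom-below`, each nontrivial
    -- element of P thus has exactly one atom in its cyclic group.
    atom-unique : ∀ {i j w} → atom i ∈ ⟪ w ⟫ → atom j ∈ ⟪ w ⟫ → i ≡ j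
    atom-unique {i} {j} gi∈ gj∈ =
      distinct (same-subgroup prime-p (atom≉ε i) (atom≉ε j) (p·atom≈ε i) (p·atom≈ε j) gi∈ gj∈)

    upperCentral : ∀ {i x} → UpperCentral G i x → (x∈ : x ∈ member P) →
                   UpperCentral (group P) i (x , x∈)
    upperCentral (trivial x≈ε) x∈ = trivial x≈ε
    upperCentral (central h)   x∈ = central λ (g , g∈) → upperCentral (h g) _

    module _ (nilpotent : IsNilpotent G) (¬cyclic : ¬ IsCyclic (group P))
             (¬quaternion : ¬ IsGeneralizedQuaternion (group P)) where

      -- A single atom would generate the socle of P, making P cyclic or generalized quaternion;
      -- this is where the hypothesis on Sylow subgroups enters.
      another-atom : ∀ j → ∃[ j′ ] j′ ≢ j
      another-atom j with Fin.all? (Fin._≟ j)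
      ... | no ¬all  = Fin.¬∀⟶∃¬ r (_≡ j) (Fin._≟ j) ¬all
      ... | yes all≡ = contradiction
        (unique-socle⇒cyclic⊎quaternion (group P) prime-p {k} orderP
          (proj₁ nilpotent , λ (x , x∈) → upperCentral (proj₂ nilpotent x) x∈)
          {atom j , atom∈ j} (atom≉ε j)
          (trans (reflexive (·-proj₁ P p _)) (p·atom≈ε j))
          (λ {g} → socle {g}))
        λ { (inj₁ cyc) → ¬cyclic cyc ; (inj₂ quat) → ¬quaternion quat }
        where
        ∈⟪atom⟫ : ∀ {g} → g ∈ member P → p · g ≈ ε → g ∈ ⟪ atom j ⟫
        ∈⟪atom⟫ {g} g∈ pg≈ε with g ≟ ε
        ... | yes g≈ε = ∈-resp (sym g≈ε) ∈-ε
        ... | no  g≉ε =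
          let j′ , aj′∈ = complete g∈ g≉ε pg≈ε
          in prime-order-generates prime-p pg≈ε
               (subst (λ j → atom j ∈ ⟪ g ⟫) (all≡ j′) aj′∈) (atom≉ε j)
        socle : ∀ {g} → proj₁ (Powers._·_ (group P) p g) ≈ ε →
                Powers.⟪_⟫ (group P) (atom j , atom∈ j) g
        socle {g , g∈} pg≈ε =
          let i , g≈ = ∈⟪atom⟫ g∈ (trans (reflexive (≡.sym (·-proj₁ P p (g , g∈)))) pg≈ε)
          in i , trans g≈ (reflexive (≡.sym (·-proj₁ P i _)))

-- Total domination in the proper enhanced power graph

module _ {a b e} (Γ : Graph a b e) where
  open Graph Γ

  listed : ∀ {k} → (Fin k → Vertex) → VertexSet Γ
  listed f = record
    { member = λ v → ∃[ i ] v ≈ f i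
    ; resp   = λ u≈v (i , eq) → i , Setoid.trans vertices (Setoid.sym vertices u≈v) eq
    }

  listed-cardinality : ∀ {k} (f : Fin k → Vertex) → (∀ {i j} → f i ≈ f j → i ≡ j) →
                       HasCardinality (VertexSet.elements (listed f)) k
  listed-cardinality f f-inj = bijection⇒card (VertexSet.elements (listed f))
    (λ i → f i , i , Setoid.refl vertices) f-inj proj₂

pairUp : ∀ {x} {X : Set x} {r} → (Fin r → X) → (Fin r → X) → Fin 2 × Fin r → X
pairUp f g (Fin.zero         , j) = f j
pairUp f g (Fin.suc Fin.zero , j) = g j

module EnhancedPowerGraph {c ℓ} (G : Group c ℓ) {n} (hasOrder : HasOrder G n) where
  open Group G
  open Powers G
  open FiniteGroup G hasOrder

  Γ = properEnhancedPowerGraph G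
  open Graph Γ using (Vertex; _~_)

  adjacent : ∀ {u v : Vertex} {w} → proj₁ u ≉ proj₁ v →
             proj₁ u ∈ ⟪ w ⟫ → proj₁ v ∈ ⟪ w ⟫ → u ~ v
  adjacent {w = w} u≉v u∈ v∈ = u≉v , w , ⟪⟫⇒⟨⟩ u∈ , ⟪⟫⇒⟨⟩ v∈

  common : ∀ {u v : Vertex} → u ~ v → ∃[ w ] proj₁ u ∈ ⟪ w ⟫ × proj₁ v ∈ ⟪ w ⟫
  common (_ , w , u∈ , v∈) = w , ⟨⟩⇒⟪⟫ u∈ , ⟨⟩⇒⟪⟫ v∈

  -- No cyclic group contains both v and u, so v is not dominating. The vertices of `Γ` are then
  -- exactly the nontrivial elements.
  module Separated
    (separate : ∀ v → v ≉ ε → ∃[ u ] (∀ {w} → v ∈ ⟪ w ⟫ → u ∉ ⟪ w ⟫)) where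

    vertex : ∀ {v} → v ≉ ε → Vertex
    vertex {v} v≉ε = v , λ dominating →
      let u , apart        = separate v v≉ε
          _ , w , v∈ , u∈  = dominating u λ u≈v → apart ∈-self (∈-resp (sym u≈v) ∈-self)
      in apart (⟨⟩⇒⟪⟫ v∈) (⟨⟩⇒⟪⟫ u∈)

    vertex≉ε : ∀ (v : Vertex) → proj₁ v ≉ ε
    vertex≉ε (v , ¬dominating) v≈ε =
      ¬dominating λ u u≉v → u≉v ∘ sym , u , (+ 0 , v≈ε) , ⟪⟫⇒⟨⟩ ∈-self

-- Groups of prime power order

module PrimePowerOrder {c ℓ} (G : Group c ℓ) {n} (hasOrder : HasOrder G n) where
  open Group G
  open Powers G
  open FiniteGroup G hasOrder
  open EnhancedPowerGraph G hasOrder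
  open Graph Γ using (Vertex; _~_)

  module Bounds {r} (atom : Fin r → Carrier) (atom≉ε : ∀ j → atom j ≉ ε)
    (atom-below : ∀ {g} → g ≉ ε → ∃[ j ] atom j ∈ ⟪ g ⟫)
    (atom-unique : ∀ i j {w} → atom i ∈ ⟪ w ⟫ → atom j ∈ ⟪ w ⟫ → i ≡ j)
    (another-atom : ∀ (j : Fin r) → ∃[ j′ ] j′ ≢ j) where

    separate : ∀ v → v ≉ ε → ∃[ u ] (∀ {w} → v ∈ ⟪ w ⟫ → u ∉ ⟪ w ⟫)
    separate v v≉ε =
      let j , aj∈   = atom-below v≉ε
          j′ , j′≢j = another-atom j
      in atom j′ , λ v∈ u∈ → j′≢j (atom-unique j′ j u∈ (∈-trans aj∈ v∈))

    open Separated separate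

    Above : Fin r → Pred Vertex ℓ
    Above j v = atom j ∈ ⟪ proj₁ v ⟫

    -- A cyclic group containing u and v contains the atoms of both, which must coincide; so edges
    -- never leave the set above one atom.
    neighbour-above : ∀ {u v j} → u ~ v → Above j u → Above j v
    neighbour-above {u} {v} {j} u~v aj∈ =
      let w , u∈ , v∈ = common {u} {v} u~v
          l , al∈     = atom-below (vertex≉ε v)
      in subst (λ l → Above l v) (atom-unique l j (∈-trans al∈ v∈) (∈-trans aj∈ u∈)) al∈

    -- Uniqueness of the atom keeps vertices above different atoms apart. The map `val` lets one
    -- argument serve both members of a dominating set and plain vertices.
    module Pairs {x} {X : Set x} (val : X → Vertex) (f g : Fin r → X)
      (f-above : ∀ j → Above j (val (f j))) (g-above : ∀ j → Above j (val (g j)))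
      (f≉g : ∀ j → proj₁ (val (f j)) ≉ proj₁ (val (g j))) where

      pairs : Fin (2 * r) → X
      pairs = pairUp f g ∘ Fin.remQuot r

      above : ∀ ij → Above (proj₂ ij) (val (pairUp f g ij))
      above (Fin.zero         , j) = f-above j
      above (Fin.suc Fin.zero , j) = g-above j

      pairUp-injective : ∀ {ij ij′} → proj₁ (val (pairUp f g ij)) ≈ proj₁ (val (pairUp f g ij′)) →
                         ij ≡ ij′
      pairUp-injective {i , j} {i′ , j′} eq = same i i′ (atom-unique j j′ (∈-respʳ eq (above (i , j))) (above (i′ , j′))) eq
        where
        same : ∀ i i′ → j ≡ j′ → proj₁ (val (pairUp f g (i , j))) ≈ proj₁ (val (pairUp f g (i′ , j′))) →
               (i , j) ≡ (i′ , j′)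
        same Fin.zero            Fin.zero            ≡.refl _  = ≡.refl
        same Fin.zero            (Fin.suc Fin.zero)  ≡.refl eq = contradiction eq (f≉g j)
        same (Fin.suc Fin.zero)  Fin.zero            ≡.refl eq = contradiction (sym eq) (f≉g j)
        same (Fin.suc Fin.zero)  (Fin.suc Fin.zero)  ≡.refl _  = ≡.refl

      pairs-injective : ∀ {i j} → proj₁ (val (pairs i)) ≈ proj₁ (val (pairs j)) → i ≡ j
      pairs-injective {i} {j} eq = ≡.trans (≡.sym (Fin.combine-remQuot {2} r i))
        (≡.trans (cong (uncurry Fin.combine) (pairUp-injective {Fin.remQuot r i} {Fin.remQuot r j} eq))
                 (Fin.combine-remQuot {2} r j))

    -- D contains a neighbour `f j` of each atom and a neighbour `g j` of `f j`. Both lie above that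
    -- atom, and adjacency makes them distinct.
    lower-bound : ∀ k → (∃[ D ] IsTotalDominating Γ D × HasCardinality (VertexSet.elements D) k) →
                  2 * r ≤ k
    lower-bound k (D , dominates , card) =
      Finite.injection⇒≤ (VertexSet.elements D) card (Pairs.pairs proj₁ f g f-above g-above f≉g)
        (Pairs.pairs-injective proj₁ f g f-above g-above f≉g)
      where
      start : Fin r → Vertex
      start j = vertex (atom≉ε j)
      f g : Fin r → Σ Vertex (VertexSet.member D)
      f j = let v , v∈ , _ = dominates (start j) in v , v∈
      g j = let v , v∈ , _ = dominates (proj₁ (f j)) in v , v∈
      f-above : ∀ j → Above j (proj₁ (f j))
      f-above j = neighbour-above {start j} {proj₁ (f j)} (proj₂ (proj₂ (dominates (start j)))) ∈-self
      g-above : ∀ j → Above j (proj₁ (g j))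
      g-above j = neighbour-above {proj₁ (f j)} {proj₁ (g j)} (proj₂ (proj₂ (dominates (proj₁ (f j))))) (f-above j)
      f≉g : ∀ j → proj₁ (proj₁ (f j)) ≉ proj₁ (proj₁ (g j))
      f≉g j = proj₁ (proj₂ (proj₂ (dominates (proj₁ (f j)))))

    -- The given set supplies a neighbour `g j` of each atom `f j`. The atom dominates all other
    -- vertices above it, and `g j` dominates the atom.
    upper-bound : HasTotalDominatingSet Γ →
                  ∃[ D ] IsTotalDominating Γ D × HasCardinality (VertexSet.elements D) (2 * r)
    upper-bound (D , dominates) =
      listed Γ pairs , total , listed-cardinality Γ pairs pairs-injective
      where
      f g : Fin r → Vertex
      f j = vertex (atom≉ε j)
      g j = proj₁ (dominates (f j))
      f~g : ∀ j → f j ~ g j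
      f~g j = proj₂ (proj₂ (dominates (f j)))
      open Pairs id f g (λ j → ∈-self) (λ j → neighbour-above {f j} {g j} (f~g j) ∈-self) (proj₁ ∘ f~g)

      listed∈ : ∀ i j → ∃[ l ] proj₁ (pairUp f g (i , j)) ≈ proj₁ (pairs l)
      listed∈ i j = Fin.combine i j ,
        reflexive (cong (proj₁ ∘ pairUp f g) (≡.sym (Fin.remQuot-combine i j)))

      total : IsTotalDominating Γ (listed Γ pairs)
      total u with j , aj∈ ← atom-below (vertex≉ε u) with proj₁ u ≟ atom j
      ... | no  u≉a = f j , listed∈ Fin.zero j , adjacent {u} {f j} u≉a ∈-self aj∈
      ... | yes u≈a =
        let w , a∈ , g∈ = common {f j} {g j} (f~g j)
        in g j , listed∈ (Fin.suc Fin.zero) j ,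
           adjacent {u} {g j} (λ u≈g → proj₁ (f~g j) (trans (sym u≈a) u≈g)) (∈-resp (sym u≈a) a∈) g∈

-- Products of commuting elements

module Products {c ℓ} (G : Group c ℓ) where
  open Group G
  open Powers G
  open import Algebra.Definitions.RawMonoid rawMonoid using (sum)
  open ≈-Reasoning setoid

  commute-ε : ∀ {y} → Commute y ε
  commute-ε = trans (identityʳ _) (sym (identityˡ _))

  commute-∙ : ∀ {y u v} → Commute y u → Commute y v → Commute y (u ∙ v)
  commute-∙ {y} {u} {v} yu yv = begin
    y ∙ (u ∙ v)  ≈⟨ assoc y u v ⟨
    (y ∙ u) ∙ v  ≈⟨ ∙-congʳ yu ⟩
    (u ∙ y) ∙ v  ≈⟨ assoc u y v ⟩
    u ∙ (y ∙ v)  ≈⟨ ∙-congˡ yv ⟩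
    u ∙ (v ∙ y)  ≈⟨ assoc u v y ⟨
    (u ∙ v) ∙ y  ∎

  sum-commute : ∀ {m y} (x : Fin m → Carrier) → (∀ i → Commute y (x i)) → Commute y (sum x)
  sum-commute {zero}  x yx = commute-ε
  sum-commute {suc m} x yx = commute-∙ (yx Fin.zero) (sum-commute (x ∘ Fin.suc) (yx ∘ Fin.suc))

  ·-sum : ∀ {m} (x : Fin m → Carrier) → (∀ i j → Commute (x i) (x j)) →
          ∀ k → k · sum x ≈ sum (λ i → k · x i)
  ·-sum {zero}  x xx k = ·-ε k
  ·-sum {suc m} x xx k = trans
    (·-distrib (sum-commute (x ∘ Fin.suc) (xx Fin.zero ∘ Fin.suc)) k)
    (∙-congˡ (·-sum (x ∘ Fin.suc) (λ i j → xx (Fin.suc i) (Fin.suc j)) k))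

  sum-ε : ∀ {m} (x : Fin m → Carrier) → (∀ i → x i ≈ ε) → sum x ≈ ε
  sum-ε {zero}  x x≈ε = refl
  sum-ε {suc m} x x≈ε =
    trans (∙-cong (x≈ε Fin.zero) (sum-ε (x ∘ Fin.suc) (x≈ε ∘ Fin.suc))) (identityʳ ε)

  sum-isolate : ∀ {m} (x : Fin m → Carrier) i → (∀ j → j ≢ i → x j ≈ ε) → sum x ≈ x i
  sum-isolate x Fin.zero    x≈ε =
    trans (∙-congˡ (sum-ε (x ∘ Fin.suc) λ j → x≈ε (Fin.suc j) λ ())) (identityʳ _)
  sum-isolate x (Fin.suc i) x≈ε = trans
    (∙-cong (x≈ε Fin.zero λ ())
            (sum-isolate (x ∘ Fin.suc) i λ j j≢i → x≈ε (Fin.suc j) (j≢i ∘ Fin.suc-injective)))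
    (identityˡ _)

  -- The k-th power of u v is that of u, which generates u since k is prime to j.
  coprime-∈-∙ : ∀ {u v j k} → Commute u v → Coprime j k → j · u ≈ ε → k · v ≈ ε → u ∈ ⟪ u ∙ v ⟫
  coprime-∈-∙ {u} {v} {j} {k} uv cop ju≈ε kv≈ε = ∈-trans
    (coprime-generates (Coprime.sym cop) ju≈ε)
    (k , sym (trans (·-distrib uv k) (trans (∙-congˡ kv≈ε) (identityʳ _))))

-- Direct products of several Sylow subgroups

another-index : ∀ {m} → 2 ≤ m → (i : Fin m) → ∃[ j ] j ≢ i
another-index (s≤s (s≤s _)) Fin.zero    = Fin.suc Fin.zero , λ ()
another-index (s≤s (s≤s _)) (Fin.suc i) = Fin.zero , λ ()

module DirectProduct {c ℓ} (G : Group c ℓ) {n} (hasOrder : HasOrder G n)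
  {m} (2≤m : 2 ≤ m) (p k M : Fin m → ℕ) (P : Fin m → Subgroup G)
  (prime-p : ∀ i → Prime (p i)) (p-injective : Injective _≡_ _≡_ p)
  (orderP : ∀ i → HasOrder (Subgroup.group (P i)) (p i ℕ.^ k i))
  (1<pᵏ : ∀ i → 1 < p i ℕ.^ k i)
  (n≡M*pᵏ : ∀ i → n ≡ M i * p i ℕ.^ k i) (p∤M : ∀ i → p i ∤ M i)
  (product : IsDirectProduct G P)
  {r : Fin m → ℕ} (atoms : ∀ i → PrimeOrder.PrimeOrderGenerators G hasOrder (P i) (p i) (r i))
  (another-atom : ∀ i (j : Fin (r i)) → ∃[ j′ ] j′ ≢ j) where
  open Group G
  open Algebra.Properties.Group G
  open import Algebra.Definitions.RawMonoid rawMonoid using (sum)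
  open Powers G
  open Products G
  open FiniteGroup G hasOrder
  open Subgroup using (member; resp; ∙-closed; ⁻¹-closed)
  open ≈-Reasoning setoid

  open PrimeOrder G hasOrder
  module Component i = PrimePowerSubgroup (P i) {p i} {k i} {r i} (prime-p i) (orderP i) (atoms i)
  module Atoms i = PrimeOrderGenerators (atoms i)
  open Atoms

  q : Fin m → ℕ
  q i = p i ℕ.^ k i

  coprime-p : ∀ {i l} → i ≢ l → Coprime (p i) (p l)
  coprime-p i≢l = distinct-primes-coprime (prime-p _) (prime-p _) (i≢l ∘ p-injective)

  coprime-q : ∀ {i l} → i ≢ l → Coprime (q i) (q l)
  coprime-q {i} {l} i≢l =
    coprime-^ (k l) (Coprime.sym (coprime-^ (k i) (Coprime.sym (coprime-p i≢l))))

  coprime-M : ∀ i → Coprime (M i) (q i)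
  coprime-M i = coprime-^ (k i) (prime∤⇒coprime (prime-p i) (p∤M i))

  q∣M : ∀ {i l} → l ≢ i → q l ∣ M i
  q∣M {i} {l} l≢i = coprime-divisor (coprime-q l≢i)
    (divides (M l) (≡.trans (ℕ.*-comm (q i) (M i)) (≡.trans (≡.sym (n≡M*pᵏ i)) (n≡M*pᵏ l))))

  q-kills : ∀ {i g} → g ∈ member (P i) → q i · g ≈ ε
  q-kills {i} = subgroup-kills (P i) (orderP i)

  M-kills : ∀ {i l g} → l ≢ i → g ∈ member (P l) → M i · g ≈ ε
  M-kills l≢i g∈ = ·-kill (q∣M l≢i) (q-kills g∈)

  -- The commutator x (y x⁻¹ y⁻¹) = (x y x⁻¹) y⁻¹ lies in both factors.
  factors-commute : ∀ {i l x y} → i ≢ l → x ∈ member (P i) → y ∈ member (P l) → Commute x y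
  factors-commute {i} {l} {x} {y} i≢l x∈ y∈ = ∙-cancelʳ ((y ∙ x) ⁻¹) (x ∙ y) (y ∙ x)
    (trans (trans (sym c≈) c≈ε) (sym (inverseʳ (y ∙ x))))
    where
    v = (x ∙ y ∙ x ⁻¹) ∙ y ⁻¹
    c≈ : v ≈ (x ∙ y) ∙ (y ∙ x) ⁻¹
    c≈ = trans (assoc _ _ _) (∙-congˡ (sym (⁻¹-anti-homo-∙ y x)))
    c∈Pl : v ∈ member (P l)
    c∈Pl = ∙-closed (P l) (proj₁ product l x y∈) (⁻¹-closed (P l) y∈)
    c∈Pi : v ∈ member (P i)
    c∈Pi = resp (P i) (trans (∙-congˡ (assoc y _ _)) (trans (sym (assoc x y _)) (sym (assoc (x ∙ y) _ _))))
      (∙-closed (P i) x∈ (proj₁ product i y (⁻¹-closed (P i) x∈)))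
    c≈ε : v ≈ ε
    c≈ε = coprime-cancel (coprime-q i≢l) (q-kills c∈Pl) (q-kills c∈Pi)

  module _ (x : Fin m → Carrier) (x∈ : ∀ i → x i ∈ member (P i)) where

    components-commute : ∀ i l → Commute (x i) (x l)
    components-commute i l with i Fin.≟ l
    ... | yes ≡.refl = refl
    ... | no  i≢l    = factors-commute i≢l (x∈ i) (x∈ l)

    -- The orders of all other factors divide `M i`, so this multiple removes every component but
    -- the i-th.
    project : ∀ i → M i · sum x ≈ M i · x i
    project i = trans (·-sum x components-commute (M i))
      (sum-isolate (λ l → M i · x l) i λ l l≢i → M-kills l≢i (x∈ l))

    component∈⟪sum⟫ : ∀ i → x i ∈ ⟪ sum x ⟫
    component∈⟪sum⟫ i = ∈-trans (coprime-generates (coprime-M i) (q-kills (x∈ i)))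
                                (M i , sym (project i))

  -- The cases distinguish whether the i-th component of g is trivial. If it is, g has order prime
  -- to `p i` and centralizes `P i`, so it shares a cyclic group with each atom of `P i`.
  atom-or-killed : ∀ g i → (∃[ j ] atom i j ∈ ⟪ g ⟫) ⊎
                   (M i · g ≈ ε × (∀ {y} → y ∈ member (P i) → Commute y g))
  atom-or-killed g i with proj₂ product g
  ... | x , (x∈ , sum≈g) , _ with x i ≟ ε
  ... | no  xi≉ε =
    let j , aj∈ = Component.atom-below i (x∈ i) xi≉ε
    in inj₁ (j , ∈-trans aj∈ (∈-respʳ sum≈g (component∈⟪sum⟫ x x∈ i)))
  ... | yes xi≈ε = inj₂
    ( (begin
        M i · g      ≈⟨ ·-congʳ (M i) sum≈g ⟨
        M i · sum x  ≈⟨ project x x∈ i ⟩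
        M i · x i    ≈⟨ ·-congʳ (M i) xi≈ε ⟩
        M i · ε      ≈⟨ ·-ε (M i) ⟩
        ε            ∎)
    , λ {y} y∈ → trans (∙-congˡ (sym sum≈g)) (trans (sum-commute x (commutes y∈)) (∙-congʳ sum≈g)))
    where
    commutes : ∀ {y} → y ∈ member (P i) → ∀ l → Commute y (x l)
    commutes y∈ l with i Fin.≟ l
    ... | no  i≢l    = factors-commute i≢l y∈ (x∈ l)
    ... | yes ≡.refl = trans (∙-congˡ xi≈ε) (trans commute-ε (∙-congʳ (sym xi≈ε)))

  atom-below : ∀ {g} → g ≉ ε → ∃₂ λ i j → atom i j ∈ ⟪ g ⟫
  atom-below {g} g≉ε with proj₂ product g
  ... | x , (x∈ , sum≈g) , _ with Fin.any? (λ i → ¬? (x i ≟ ε))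
  ... | no  none       = contradiction
    (trans (sym sum≈g) (sum-ε x λ i → decidable-stable (x i ≟ ε) λ xi≉ε → none (i , xi≉ε))) g≉ε
  ... | yes (i , xi≉ε) =
    let j , aj∈ = Component.atom-below i (x∈ i) xi≉ε
    in i , j , ∈-trans aj∈ (∈-respʳ sum≈g (component∈⟪sum⟫ x x∈ i))

  some-atom : ∀ i → Fin (r i)
  some-atom i =
    let g , g∈ , g≉ε = subgroup-nontrivial (P i) (1<pᵏ i) (orderP i)
    in proj₁ (Component.atom-below i g∈ g≉ε)

  separate : ∀ v → v ≉ ε → ∃[ u ] (∀ {w} → v ∈ ⟪ w ⟫ → u ∉ ⟪ w ⟫)
  separate v v≉ε =
    let i , j , aj∈ = atom-below v≉ε
        j′ , j′≢j   = another-atom i j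
    in atom i j′ , λ v∈ u∈ → j′≢j (Component.atom-unique i u∈ (∈-trans aj∈ v∈))

  open EnhancedPowerGraph G hasOrder
  open Separated separate
  open Graph Γ using (Vertex; _~_)

  -- The set consists of the atoms of `P i` and one atom z of another factor. By `atom-or-killed`
  -- every vertex is adjacent to an atom of `P i` or is one itself, and then it is adjacent to z.
  upper-bound : ∀ i → ∃[ D ] IsTotalDominating Γ D × HasCardinality (VertexSet.elements D) (r i + 1)
  upper-bound i = listed Γ f , total , listed-cardinality Γ f f-inj
    where
    l = proj₁ (another-index 2≤m i)
    l≢i = proj₂ (another-index 2≤m i)
    a : Fin (r i) → Vertex
    a j = vertex (atom≉ε i j)
    z : Vertex
    z = vertex (atom≉ε l (some-atom l))

    f′ : Fin (r i) ⊎ Fin 1 → Vertex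
    f′ (inj₁ j) = a j
    f′ (inj₂ _) = z
    f : Fin (r i + 1) → Vertex
    f = f′ ∘ Fin.splitAt (r i)

    a≉z : ∀ j → proj₁ (a j) ≉ proj₁ z
    a≉z j a≈z = atom≉ε i j (coprime-cancel (coprime-p (l≢i ∘ ≡.sym))
      (trans (·-congʳ (p l) a≈z) (p·atom≈ε l _)) (p·atom≈ε i j))

    f′-inj : ∀ s t → proj₁ (f′ s) ≈ proj₁ (f′ t) → s ≡ t
    f′-inj (inj₁ j)        (inj₁ j′)       eq = cong inj₁ (distinct i (∈-resp (sym eq) ∈-self))
    f′-inj (inj₁ j)        (inj₂ _)        eq = contradiction eq (a≉z j)
    f′-inj (inj₂ _)        (inj₁ j)        eq = contradiction (sym eq) (a≉z j)
    f′-inj (inj₂ Fin.zero) (inj₂ Fin.zero) _  = ≡.refl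

    f-inj : ∀ {s t} → proj₁ (f s) ≈ proj₁ (f t) → s ≡ t
    f-inj {s} {t} eq = ≡.trans (≡.sym (Fin.join-splitAt (r i) 1 s))
      (≡.trans (cong (Fin.join (r i) 1) (f′-inj (Fin.splitAt (r i) s) (Fin.splitAt (r i) t) eq))
               (Fin.join-splitAt (r i) 1 t))

    listed∈ : ∀ s → ∃[ t ] proj₁ (f′ s) ≈ proj₁ (f t)
    listed∈ s = Fin.join (r i) 1 s , reflexive (cong (proj₁ ∘ f′) (≡.sym (Fin.splitAt-join (r i) 1 s)))

    total : IsTotalDominating Γ (listed Γ f)
    total u with atom-or-killed (proj₁ u) i
    ... | inj₂ (Mu≈ε , commutes) =
      a j , listed∈ (inj₁ j) , adjacent {u} {a j} u≉a
        (coprime-∈-∙ (sym (commutes (atom∈ i j))) (coprime-M′) Mu≈ε (p·atom≈ε i j))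
        (∈-respʳ (commutes (atom∈ i j))
          (coprime-∈-∙ (commutes (atom∈ i j)) (Coprime.sym coprime-M′) (p·atom≈ε i j) Mu≈ε))
      where
      j = some-atom i
      coprime-M′ = prime∤⇒coprime (prime-p i) (p∤M i)
      u≉a : proj₁ u ≉ atom i j
      u≉a u≈a = atom≉ε i j (coprime-cancel coprime-M′ (p·atom≈ε i j)
        (trans (·-congʳ (M i) (sym u≈a)) Mu≈ε))
    ... | inj₁ (j , aj∈) with proj₁ u ≟ atom i j
    ...   | no  u≉a = a j , listed∈ (inj₁ j) , adjacent {u} {a j} u≉a ∈-self aj∈
    ...   | yes u≈a = z , listed∈ (inj₂ Fin.zero) ,
      adjacent {u} {z} (λ u≈z → a≉z j (trans (sym u≈a) u≈z))
        (∈-resp (sym u≈a) (coprime-∈-∙ az (coprime-p (l≢i ∘ ≡.sym)) (p·atom≈ε i j) (p·atom≈ε l _)))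
        (∈-respʳ (sym az) (coprime-∈-∙ (sym az) (coprime-p l≢i) (p·atom≈ε l _) (p·atom≈ε i j)))
      where
      az : Commute (atom i j) (proj₁ z)
      az = factors-commute (l≢i ∘ ≡.sym) (atom∈ i j) (atom∈ l _)

  module _ {s} (D : VertexSet Γ) (dominates : IsTotalDominating Γ D)
           (card : HasCardinality (VertexSet.elements D) s) where
    private E = Σ Vertex (VertexSet.member D)

    Met : ∀ i → Fin (r i) → Set _
    Met i j = Σ[ v ∈ E ] atom i j ∈ ⟪ proj₁ (proj₁ v) ⟫

    met? : ∀ i j → Dec (Met i j)
    met? i j = Finite.any? (VertexSet.elements D) card ∈-respʳ (λ v → atom i j ∈?⟪ proj₁ (proj₁ v) ⟫)

    -- Otherwise the product of generators of unmet subgroups, one for each i,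
    -- has no neighbour in D.
    ∃all-met : ∃[ i ] ∀ j → Met i j
    ∃all-met = decidable-stable (Fin.any? λ i → Fin.all? (met? i)) λ ¬∃ →
      unmet λ i → Fin.¬∀⟶∃¬ (r i) (Met i) (met? i) λ all → ¬∃ (i , all)
      where
      unmet : (∀ i → ∃[ j ] ¬ Met i j) → ⊥
      unmet missed =
        -- The neighbour v has an atom of some `P i` in its cyclic group. A cyclic group containing
        -- u and v contains `x i` too, so that atom is `x i`, which D was supposed to miss.
        let v , v∈ , u~v  = dominates u
            w , u∈w , v∈w = common {u} {v} u~v
            i , j , aj∈   = atom-below (vertex≉ε v)
            j≡            = Component.atom-unique i (∈-trans aj∈ v∈w)
                              (∈-trans (component∈⟪sum⟫ x x∈ i) u∈w)
        in proj₂ (missed i) ((v , v∈) , subst (λ j → atom i j ∈ ⟪ proj₁ v ⟫) j≡ aj∈)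
        where
        x : Fin m → Carrier
        x i = atom i (proj₁ (missed i))
        x∈ : ∀ i → x i ∈ member (P i)
        x∈ i = atom∈ i (proj₁ (missed i))
        i₀ : Fin m
        -- The bound reads 1 < m, so this is index 1; one nontrivial component shows that the
        -- product is nontrivial.
        i₀ = fromℕ< 2≤m
        u : Vertex
        u = vertex {sum x} λ sum≈ε →
          let t , x≈ = component∈⟪sum⟫ x x∈ i₀
          in atom≉ε i₀ (proj₁ (missed i₀)) (trans x≈ (trans (·-congʳ t sum≈ε) (·-ε t)))

    -- The elements of D above the subgroups of order p i are non-adjacent, so a
    -- neighbour in D of one of them is a further element.
    all-met⇒≤ : ∀ i → (∀ j → Met i j) → r i + 1 ≤ s
    all-met⇒≤ i met = Finite.injection⇒≤ (VertexSet.elements D) card f (λ {s} {t} → f-inj {s} {t})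
      where
      above : Fin (r i) → E
      above j = proj₁ (met j)
      base : E
      base = above (some-atom i)
      extra : E
      extra = let v , v∈ , _ = dominates (proj₁ base) in v , v∈
      base~extra : proj₁ base ~ proj₁ extra
      base~extra = proj₂ (proj₂ (dominates (proj₁ base)))

      f′ : Fin (r i) ⊎ Fin 1 → E
      f′ (inj₁ j) = above j
      f′ (inj₂ _) = extra
      f : Fin (r i + 1) → E
      f = f′ ∘ Fin.splitAt (r i)

      above≉extra : ∀ j → proj₁ (proj₁ (above j)) ≉ proj₁ (proj₁ extra)
      above≉extra j eq =
        -- If `above j` were `extra`, the cyclic group of the edge would contain atom j and the atom
        -- of `base`. These would coincide, making `extra` equal to its neighbour `base`.
        let w , base∈ , extra∈ = common {proj₁ base} {proj₁ extra} base~extra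
            j≡ = Component.atom-unique i (∈-trans (∈-respʳ eq (proj₂ (met j))) extra∈)
                                         (∈-trans (proj₂ (met (some-atom i))) base∈)
        in proj₁ base~extra (subst (λ j → proj₁ (proj₁ (above j)) ≈ proj₁ (proj₁ extra)) j≡ eq)

      f′-inj : ∀ s t → proj₁ (proj₁ (f′ s)) ≈ proj₁ (proj₁ (f′ t)) → s ≡ t
      f′-inj (inj₁ j)        (inj₁ j′)       eq =
        cong inj₁ (Component.atom-unique i (∈-respʳ eq (proj₂ (met j))) (proj₂ (met j′)))
      f′-inj (inj₁ j)        (inj₂ _)        eq = contradiction eq (above≉extra j)
      f′-inj (inj₂ _)        (inj₁ j)        eq = contradiction (sym eq) (above≉extra j)
      f′-inj (inj₂ Fin.zero) (inj₂ Fin.zero) _  = ≡.refl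

      f-inj : ∀ {s t} → proj₁ (proj₁ (f s)) ≈ proj₁ (proj₁ (f t)) → s ≡ t
      f-inj {s} {t} eq = ≡.trans (≡.sym (Fin.join-splitAt (r i) 1 s))
        (≡.trans (cong (Fin.join (r i) 1) (f′-inj (Fin.splitAt (r i) s) (Fin.splitAt (r i) t) eq))
                 (Fin.join-splitAt (r i) 1 t))

    lower-bound : ∃[ i ] r i + 1 ≤ s
    lower-bound = let i , met = ∃all-met in i , all-met⇒≤ i met

-- The prime power case and the direct product case

module _ {c ℓ} (G : Group c ℓ) where
  open Group G
  open Powers G

  -- The predicate `x ≈ x` is a true proposition at the level that `Subgroup` prescribes. It lets a
  -- p-group be treated as its own Sylow subgroup.
  fullSubgroup : Subgroup G
  fullSubgroup = record
    { member    = λ x → x ≈ x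
    ; resp      = λ _ _ → refl
    ; ε-closed  = refl
    ; ∙-closed  = λ _ _ → refl
    ; ⁻¹-closed = λ _ → refl
    }

  fullSubgroup-order : ∀ {n} → HasOrder G n → HasOrder (Subgroup.group fullSubgroup) n
  fullSubgroup-order hasOrder = record
    { to        = to ∘ proj₁
    ; from      = λ i → from i , refl
    ; to-cong   = to-cong
    ; from-cong = from-cong
    ; inverse   = (λ eq → Inverse.inverseˡ hasOrder eq) , λ eq → Inverse.inverseʳ hasOrder eq
    }
    where open Inverse hasOrder using (to; from; to-cong; from-cong)

  fullSubgroup-card : ∀ {p r} → HasCardinality (subgroupsOfOrder {G = G} p) r →
                      HasCardinality (subgroupsOfOrderIn p fullSubgroup) r
  fullSubgroup-card card = record
    { to        = λ (H , _ , orderH) → to (H , orderH)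
    ; from      = λ i → proj₁ (from i) , (λ _ → refl) , proj₂ (from i)
    ; to-cong   = to-cong
    ; from-cong = from-cong
    ; inverse   = (λ eq → Inverse.inverseˡ card eq) , λ eq → Inverse.inverseʳ card eq
    }
    where open Inverse card using (to; from; to-cong; from-cong)

  module _ {n} (hasOrder : HasOrder G n) (nontrivial : IsNontrivial G) (nilpotent : IsNilpotent G)
    (sylow : ∀ q → Prime q → q ∣ n → ∀ (P : Subgroup G) → IsSylow q P →
      ¬ IsCyclic (Subgroup.group P) × ¬ IsGeneralizedQuaternion (Subgroup.group P)) where

    prime-power-case : ∀ p r → Prime p → IsPGroup G p →
      HasCardinality (subgroupsOfOrder {G = G} p) r →
      HasTotalDominatingSet (properEnhancedPowerGraph G) →
      IsStrongDominationNumber (properEnhancedPowerGraph G) (2 * r)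
    prime-power-case p r prime-p (k , order-pᵏ) card total =
      upper-bound total , lower-bound
      where
      n≡pᵏ : n ≡ p ℕ.^ k
      n≡pᵏ = card-unique {S = setoid} hasOrder order-pᵏ

      p∣pᵏ : ∀ k → HasOrder G (p ℕ.^ k) → p ∣ p ℕ.^ k
      p∣pᵏ zero    order-1 = contradiction
        (trans (sym (identityʳ _)) (FiniteGroup.order-kills G order-1 (proj₁ nontrivial))) (proj₂ nontrivial)
      p∣pᵏ (suc k) _       = m∣m*n (p ℕ.^ k)

      1<p : 1 < p
      1<p = ℕ.nonTrivial⇒n>1 p {{prime⇒nonTrivial prime-p}}

      isSylow : IsSylow p fullSubgroup
      isSylow = p ℕ.^ k , k , order-pᵏ , fullSubgroup-order order-pᵏ , ∣-refl , λ pᵏ⁺¹∣pᵏ →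
        ℕ.<⇒≱ (ℕ.^-monoʳ-< p 1<p (ℕ.n<1+n k)) (∣⇒≤ pᵏ⁺¹∣pᵏ)
        where instance _ = ℕ.m^n≢0 p k {{prime⇒nonZero prime-p}}

      open PrimeOrder G hasOrder
      atoms = primeOrderGenerators prime-p fullSubgroup (fullSubgroup-card card)
      open PrimeOrderGenerators atoms
      open PrimePowerSubgroup fullSubgroup {k = k} prime-p (fullSubgroup-order order-pᵏ) atoms
      not-cyclic-quaternion =
        sylow p prime-p (subst (p ∣_) (≡.sym n≡pᵏ) (p∣pᵏ k order-pᵏ)) fullSubgroup isSylow
      atom-unique′ : ∀ i j {w} → atom i ∈ ⟪ w ⟫ → atom j ∈ ⟪ w ⟫ → i ≡ j
      atom-unique′ i j = atom-unique {i} {j}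
      open PrimePowerOrder.Bounds G hasOrder atom atom≉ε (atom-below refl) atom-unique′
        (another-atom nilpotent (proj₁ not-cyclic-quaternion) (proj₂ not-cyclic-quaternion))
        using (upper-bound; lower-bound)

    direct-product-case : ∀ m → 2 ≤ m → (p : Fin m → ℕ) (P : Fin m → Subgroup G) (r : Fin m → ℕ) →
      Injective _≡_ _≡_ p →
      (∀ q → (Prime q × q ∣ n) ⇔ (∃[ i ] p i ≡ q)) →
      (∀ i → IsSylow (p i) (P i)) →
      IsDirectProduct G P →
      (∀ i → HasCardinality (subgroupsOfOrderIn {G = G} (p i) (P i)) (r i)) →
      ∀ s → IsLeast (λ k → ∃[ i ] r i ≡ k) s →
      IsStrongDominationNumber (properEnhancedPowerGraph G) (s + 1)
    direct-product-case m 2≤m p P r p-injective primes isSylow product cards s ((i , ≡.refl) , least) =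
      upper-bound i , λ k (D , dominates , card) →
        -- The index l depends on D; the minimality of s compares `r l` with `r i`.
        let l , rl<k = lower-bound D dominates card
        in ℕ.≤-trans (ℕ.+-monoˡ-≤ 1 (least (r l) (l , ≡.refl))) rl<k
      where
      prime-p : ∀ i → Prime (p i)
      prime-p i = proj₁ (Equivalence.from (primes (p i)) (i , ≡.refl))
      p∣n : ∀ i → p i ∣ n
      p∣n i = proj₂ (Equivalence.from (primes (p i)) (i , ≡.refl))

      k : Fin m → ℕ
      k i = proj₁ (proj₂ (isSylow i))
      orderP : ∀ i → HasOrder (Subgroup.group (P i)) (p i ℕ.^ k i)
      orderP i = proj₁ (proj₂ (proj₂ (proj₂ (isSylow i))))
      pᵏ∣n : ∀ i → p i ℕ.^ k i ∣ n
      pᵏ∣n i = let n′ , _ , order′ , _ , pᵏ∣n′ , _ = isSylow i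
               in subst (p i ℕ.^ k i ∣_) (card-unique {S = setoid} order′ hasOrder) pᵏ∣n′
      pᵏ⁺¹∤n : ∀ i → p i ℕ.^ suc (k i) ∤ n
      pᵏ⁺¹∤n i = let n′ , _ , order′ , _ , _ , ∤n′ = isSylow i
                 in ∤n′ ∘ subst (p i ℕ.^ suc (k i) ∣_) (card-unique {S = setoid} hasOrder order′)
      M : Fin m → ℕ
      M i = quotient (pᵏ∣n i)
      n≡M*pᵏ : ∀ i → n ≡ M i * p i ℕ.^ k i
      n≡M*pᵏ i = _∣_.equality (pᵏ∣n i)
      p∤M : ∀ i → p i ∤ M i
      p∤M i p∣M = pᵏ⁺¹∤n i (subst (p i ℕ.^ suc (k i) ∣_) (≡.sym (n≡M*pᵏ i))
        (*-monoˡ-∣ (p i ℕ.^ k i) p∣M))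
      1<pᵏ : ∀ i → 1 < p i ℕ.^ k i
      1<pᵏ i = power (k i) ≡.refl
        where
        power : ∀ e → e ≡ k i → 1 < p i ℕ.^ e
        -- Exponent 0 would give `M i` = n, which `p i` divides.
        power zero    0≡k = contradiction (subst (p i ∣_) (≡.trans (n≡M*pᵏ i)
          (≡.trans (cong (λ e → M i * p i ℕ.^ e) (≡.sym 0≡k)) (ℕ.*-identityʳ (M i)))) (p∣n i)) (p∤M i)
        power (suc e) _   =
          ℕ.^-monoʳ-< (p i) (ℕ.nonTrivial⇒n>1 (p i) {{prime⇒nonTrivial (prime-p i)}}) (s≤s (z≤n {e}))

      open PrimeOrder G hasOrder
      atoms : ∀ i → PrimeOrderGenerators (P i) (p i) (r i)
      atoms i = primeOrderGenerators (prime-p i) (P i) (cards i)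
      another-atom : ∀ i (j : Fin (r i)) → ∃[ j′ ] j′ ≢ j
      another-atom i =
        let ¬cyclic , ¬quaternion = sylow (p i) (prime-p i) (p∣n i) (P i) (isSylow i)
        in PrimePowerSubgroup.another-atom (P i) {k = k i} (prime-p i) (orderP i) (atoms i)
             nilpotent ¬cyclic ¬quaternion
      open DirectProduct G hasOrder 2≤m p k M P prime-p p-injective orderP 1<pᵏ n≡M*pᵏ p∤M
        product atoms another-atom using (upper-bound; lower-bound)

theorem2p2 : ∀ {c ℓ} (G : Group c ℓ) (n : ℕ) → HasOrder G n →
    IsNontrivial G → IsNilpotent G →
    (∀ q → Prime q → q ∣ n → ∀ (P : Subgroup G) → IsSylow q P →
    ¬ IsCyclic (Subgroup.group P) × ¬ IsGeneralizedQuaternion (Subgroup.group P)) →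
    (∀ p r → Prime p → IsPGroup G p →
    HasCardinality (subgroupsOfOrder {G = G} p) r →
    HasTotalDominatingSet (properEnhancedPowerGraph G) →
    IsStrongDominationNumber (properEnhancedPowerGraph G) (2 * r))
    ×
    (∀ m → 2 ≤ m → (p : Fin m → ℕ) (P : Fin m → Subgroup G) (r : Fin m → ℕ) →
    Injective _≡_ _≡_ p →
    (∀ q → (Prime q × q ∣ n) ⇔ (∃[ i ] p i ≡ q)) →
    (∀ i → IsSylow (p i) (P i)) →
    IsDirectProduct G P →
    (∀ i → HasCardinality (subgroupsOfOrderIn {G = G} (p i) (P i)) (r i)) →
    ∀ s → IsLeast (λ k → ∃[ i ] r i ≡ k) s →
    IsStrongDominationNumber (properEnhancedPowerGraph G) (s + 1))
theorem2p2 G n hasOrder nontrivial nilpotent sylow =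
  prime-power-case G hasOrder nontrivial nilpotent sylow ,
  direct-product-case G hasOrder nontrivial nilpotent sylow
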